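{- Let $f(X)=a_nX^n+\cdots+a_1X+a_0$ be a polynomial with real coefficients of degree $n\ge 1$ with $a_n>0$, having $s\ge 1$ sign changes between consecutive non-zero coefficients. Let $k=\lfloor \frac{s}{2}\rfloor+1$ and, for $1\le j\le k$, let $$v_j=\max\left\{1,\ \max_{n_j\le i\le N_j}\left(\frac{S_j^- }{S_j^+}\right)^{\frac{1}{p_j-i}}\right\},$$ where $p_j,n_j,N_j,S_j^+,S_j^-$ are the quantities attached to the sign pattern of $f$ defined in the context. Then $f$ has no zeros in the sector $S_{v,\frac{\pi}{n}}$ with $v=\max\{v_1,\dots,v_{\lfloor s/2\rfloor+1}\}$.
   Context: For real numbers $v,\theta$ with $0<\theta\le\pi$, define the open sector $S_{v,\theta}=\{z=v+\rho e^{i\varphi}\in\mathbb{C}:\rho>0,\ |\varphi|<\theta\}$ (with $\varphi$ real). Sign pattern. List the non-zero coefficients of $f$ in order of decreasing index and partition this list into maximal runs of consecutive (in the list) coefficients of the same sign. Since $a_n>0$, the first run is positive, and runs alternate in sign; there are $s+1$ runs. The $j$-th positive run consists of the non-zero coefficients with indices between $p_j$ and $P_j$, where $P_j$ is its largest and $p_j$ its smallest index; the $j$-th negative run consists of the non-zero coefficients with indices between $n_j$ and $N_j$, where $N_j$ is its largest and $n_j$ its smallest index. Thus $n=P_1\ge p_1>N_1\ge n_1>P_2\ge p_2>N_2\ge n_2>\cdots$. Put $S_j^+=\sum_{p_j\le i\le P_j}|a_i|$ and $S_j^-=\sum_{n_j\le i\le N_j}|a_i|$. With $k=\lfloor s/2\rfloor+1$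 there are $k$ positive runs; there are $k$ negative runs if $s$ is odd and $k-1$ if $s$ is even. If $s$ is even (no $k$-th negative run), one sets $S_k^-=0$ and the inner maximum defining $v_k$ is omitted, so $v_k=1$. -}

module Defs where

open import Algebra.Bundles using (CommutativeRing)
open import Algebra.Bundles.Raw using (RawRing)
import Algebra.Definitions.RawSemiring as RawSemiringDefs
open import Data.Bool.Base using (if_then_else_)
open import Data.Fin.Base as Fin using (Fin; toℕ)
import Data.Fin.Properties as Fin
open import Data.List.Base as List using (List; []; _∷_)
open import Data.List.NonEmpty.Base as List⁺ using (List⁺)
open import Data.Maybe.Base using (Maybe; just)
open import Data.Nat.Base as ℕ using (ℕ; suc; ⌊_/2⌋)
open import Data.Product.Base using (∃; ∃-syntax; Σ-syntax; _×_; _,_; proj₁; proj₂)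
open import Data.Sum.Base using (_⊎_)
open import Data.Vec.Functional using (Vector)
open import Level using (0ℓ)
open import Relation.Binary.Core using (Rel)
import Relation.Binary.Construct.StrictToNonStrict as ToNonStrict
open import Relation.Binary.PropositionalEquality.Core using (_≡_)
open import Relation.Binary.Structures using (IsStrictTotalOrder)
open import Relation.Nullary.Decidable using (does; ¬?; _×-dec_)
open import Relation.Nullary.Negation.Core using (¬_)

-- The classical axioms of ℝ: a totally ordered field in which every inhabited
-- set that is bounded above has a least upper bound.  Classically they
-- determine ℝ up to unique isomorphism.  The order is total in the classical
-- sense (trichotomy is decided), so listing the non-zero coefficients of a
-- polynomial and comparing their signs are honest functions.
record CompleteOrderedField : Set₁ where
  infix  4 _<_
  infix  8 _⁻¹

  field
    commutativeRing : CommutativeRing 0ℓ 0ℓ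

  open CommutativeRing commutativeRing public

  field
    _<_                : Rel Carrier 0ℓ
    isStrictTotalOrder : IsStrictTotalOrder _≈_ _<_

  open IsStrictTotalOrder isStrictTotalOrder public
    using (compare; _≟_; _<?_)
  open ToNonStrict _≈_ _<_ public using (_≤_)

  -- The value of _⁻¹ at 0# is unspecified.
  field
    1≉0         : ¬ (1# ≈ 0#)
    _⁻¹         : Carrier → Carrier
    ⁻¹-inverseʳ : ∀ x → ¬ (x ≈ 0#) → x * x ⁻¹ ≈ 1#
    +-monoʳ-<   : ∀ x {y z} → y < z → x + y < x + z
    *-pos       : ∀ {x y} → 0# < x → 0# < y → 0# < x * y

  IsUpperBound : (Carrier → Set) → Carrier → Set
  IsUpperBound P b = ∀ x → P x → x ≤ b

  field
    complete : ∀ (P : Carrier → Set) → ∃ P → ∃ (IsUpperBound P) →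
               ∃[ b ] (IsUpperBound P b × (∀ c → IsUpperBound P c → b ≤ c))

module Real (ℝ : CompleteOrderedField) where
  open CompleteOrderedField ℝ public
  open RawSemiringDefs (RawRing.rawSemiring rawRing) public
    using (_^_; sum) renaming (_×_ to _·_)

  infixl 7 _/_
  _/_ : Carrier → Carrier → Carrier
  x / y = x * y ⁻¹

  fromNat : ℕ → Carrier
  fromNat m = m · 1#

  ∣_∣ : Carrier → Carrier
  ∣ x ∣ = if does (x <? 0#) then - x else x

  IsMax : (Carrier → Set) → Carrier → Set
  IsMax P v = P v × IsUpperBound P v

  -- r = x ^ (1 / m), for x ≥ 0 and m ≥ 1.
  IsRoot : ℕ → Carrier → Carrier → Set
  IsRoot m x r = 0# ≤ r × r ^ m ≈ x

module Complex (ℝ : CompleteOrderedField) where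
  open Real ℝ

  infix 6 _+i_
  record ℂ : Set where
    constructor _+i_
    field
      re : Carrier
      im : Carrier
  open ℂ public

  infix 4 _≈ℂ_
  _≈ℂ_ : Rel ℂ 0ℓ
  z ≈ℂ w = re z ≈ re w × im z ≈ im w

  ℂ-rawRing : RawRing 0ℓ 0ℓ
  ℂ-rawRing = record
    { Carrier = ℂ
    ; _≈_     = _≈ℂ_
    ; _+_     = λ z w → (re z + re w) +i (im z + im w)
    ; _*_     = λ z w → (re z * re w - im z * im w) +i (re z * im w + im z * re w)
    ; -_      = λ z → (- re z) +i (- im z)
    ; 0#      = 0# +i 0#
    ; 1#      = 1# +i 0#
    }

  open RawRing ℂ-rawRing public
    using () renaming (_+_ to _+ℂ_; _*_ to _*ℂ_; -_ to -ℂ_; 0# to 0ℂ; 1# to 1ℂ)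
  open RawSemiringDefs (RawRing.rawSemiring ℂ-rawRing) public
    using () renaming (_^_ to _^ℂ_; sum to sumℂ)

  ofReal : Carrier → ℂ
  ofReal x = x +i 0#

  normSq : ℂ → Carrier
  normSq z = re z * re z + im z * im z

  -- normSq w < ε * ε says |w| < ε.
  ConvergesTo : (ℕ → ℂ) → ℂ → Set
  ConvergesTo u l = ∀ ε → 0# < ε → ∃[ M ] (∀ m → M ℕ.≤ m → normSq (u m +ℂ -ℂ l) < ε * ε)

  expPartialSum : ℂ → ℕ → ℂ
  expPartialSum w m = sumℂ {m} λ k → ofReal (fromNat (toℕ k ℕ.!) ⁻¹) *ℂ (w ^ℂ toℕ k)

  -- e = exp w, by the power series.
  IsExp : ℂ → ℂ → Set
  IsExp w e = ConvergesTo (expPartialSum w) e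

  -- e = exp (i φ)
  IsCis : Carrier → ℂ → Set
  IsCis φ e = IsExp (0# +i φ) e

  -- π is the least positive zero of sin, where sin x = Im (exp (i x)).
  IsPi : Carrier → Set
  IsPi π = 0# < π
         × (∃[ e ] (IsCis π e × im e ≈ 0#))
         × (∀ x → 0# < x → x < π → ∀ e → IsCis x e → ¬ (im e ≈ 0#))

  Sector : Carrier → Carrier → ℂ → Set
  Sector v θ z = ∃[ ρ ] ∃[ φ ] ∃[ e ]
    (0# < ρ × ∣ φ ∣ < θ × IsCis φ e × z ≈ℂ ofReal v +ℂ ofReal ρ *ℂ e)

-- The polynomial a₀ + a₁ X + … + aₙ Xⁿ.
module Polynomial (ℝ : CompleteOrderedField) {n : ℕ}
                  (a : Vector (CompleteOrderedField.Carrier ℝ) (suc n)) where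
  open Real ℝ
  open Complex ℝ

  eval : ℂ → ℂ
  eval z = sumℂ λ i → ofReal (a i) *ℂ (z ^ℂ toℕ i)

  -- Indices of the non-zero coefficients, in decreasing order.
  support : List (Fin (suc n))
  support = List.filter (λ i → ¬? (a i ≟ 0#)) (List.reverse (List.allFin (suc n)))

  countChanges : List (Fin (suc n)) → ℕ
  countChanges (i ∷ js@(j ∷ _)) =
    if does (a i * a j <? 0#) then suc (countChanges js) else countChanges js
  countChanges _ = 0

  signChanges : ℕ
  signChanges = countChanges support

  -- On the support, the coefficients that are not positive are negative, so
  -- the inj₁ groups are the positive runs and the inj₂ groups the negative
  -- runs; both kinds are listed by decreasing index.
  runs : List (List⁺ (Fin (suc n))) × List (List⁺ (Fin (suc n)))
  runs = List.partitionSums (List⁺.groupSeqs (λ i → 0# <? a i) support)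

  positiveRuns negativeRuns : List (List⁺ (Fin (suc n)))
  positiveRuns = proj₁ runs
  negativeRuns = proj₂ runs

  -- Runs are numbered from 0; a run that does not exist gives nothing.
  positiveRun negativeRun : ℕ → Maybe (List⁺ (Fin (suc n)))
  positiveRun j = List.head (List.drop j positiveRuns)
  negativeRun j = List.head (List.drop j negativeRuns)

  largest smallest : List⁺ (Fin (suc n)) → Fin (suc n)
  largest  = List⁺.head
  smallest = List⁺.last

  Within : List⁺ (Fin (suc n)) → Fin (suc n) → Set
  Within r i = smallest r Fin.≤ i × i Fin.≤ largest r

  -- S_j^±, the sum of |aᵢ| over all indices i spanned by the run.
  S : List⁺ (Fin (suc n)) → Carrier
  S r = sum λ i →
    if does ((smallest r Fin.≤? i) ×-dec (i Fin.≤? largest r)) then ∣ a i ∣ else 0#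

  k : ℕ
  k = ⌊ signChanges /2⌋ ℕ.+ 1

  -- The numbers whose maximum is v_j: the number 1 and, if there is a j-th
  -- negative run, the roots (S_j^- / S_j^+) ^ (1 / (p_j - i)), n_j ≤ i ≤ N_j.
  -- As for the runs, j counts from 0.
  data Candidate (j : ℕ) (w : Carrier) : Set where
    one  : w ≈ 1# → Candidate j w
    root : ∀ {pos neg} → positiveRun j ≡ just pos → negativeRun j ≡ just neg →
           ∀ i → Within neg i →
           IsRoot (toℕ (smallest pos) ℕ.∸ toℕ i) (S neg / S pos) w →
           Candidate j w

  -- The second argument is v_j.
  IsLocalBound : ℕ → Carrier → Set
  IsLocalBound j = IsMax (Candidate j)

  -- The argument is v = max {v_1, …, v_k}.
  IsBound : Carrier → Set
  IsBound v = Σ[ vs ∈ Vector Carrier k ]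
    ((∀ j → IsLocalBound (toℕ j) (vs j)) × IsMax (λ w → ∃[ j ] (w ≈ vs j)) v)

{-# OPTIONS --safe #-}
module Submission where

open import Defs
open import Algebra.Bundles using (CommutativeRing)
import Algebra.Properties.Monoid.Mult as MonoidMult
import Algebra.Properties.Ring as RingProperties
import Algebra.Properties.Semiring.Mult as SemiringMult
import Algebra.Properties.Semiring.Mult.TCOptimised as TCOptimisedMult
import Algebra.Properties.Semiring.Sum as SemiringSum
import Algebra.Solver.Ring
open import Algebra.Solver.Ring.AlmostCommutativeRing using (fromCommutativeRing; _-Raw-AlmostCommutative⟶_)
open import Data.Bool.Base using (Bool; true; false; if_then_else_)
open import Data.Empty using (⊥-elim)
open import Data.Fin.Base as Fin using (Fin; zero; suc; toℕ; fromℕ; fromℕ<)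
import Data.Fin.Properties as Fin
open import Data.Integer.Base as ℤ using (ℤ; +_; -[1+_]; +[1+_]; _⊖_)
import Data.Integer.Properties as ℤ
open import Data.List.Base as List using (List; []; _∷_; _++_; _∷ʳ_; [_]; length; drop; head; reverse; filter; partitionSums; tabulate; allFin)
open import Data.List.Membership.Propositional using (_∈_)
open import Data.List.Membership.Propositional.Properties using (∈-allFin; ∈-filter⁺; ∈-++⁺ʳ)
open import Data.List.NonEmpty.Base as List⁺ using (List⁺; _∷_; toList; groupSeqs; ungroupSeqs; snocView; _∷ʳ′_; last)
import Data.List.NonEmpty.Properties as List⁺
open import Data.List.NonEmpty.Relation.Unary.All using (toList⁺) renaming (All to All⁺)
import Data.List.Properties as List
open import Data.List.Relation.Unary.All as All using (All; []; _∷_)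
import Data.List.Relation.Unary.All.Properties as All
open import Data.List.Relation.Unary.AllPairs using (AllPairs; []; _∷_)
import Data.List.Relation.Unary.AllPairs.Properties as AllPairs
open import Data.List.Relation.Unary.Any using (here; there)
import Data.List.Relation.Unary.Any.Properties as Any
open import Data.Maybe.Base as Maybe using (just)
open import Data.Nat.Base as ℕ using (ℕ; zero; suc; s≤s; z≤n; _!; ⌊_/2⌋; _≥_)
import Data.Nat.Properties as ℕ
open import Data.Product.Base using (∃-syntax; _×_; _,_; proj₁; proj₂)
open import Data.Sum.Base using (_⊎_; inj₁; inj₂)
import Data.Sum.Relation.Unary.All as Sum
open import Data.Vec.Functional using (Vector)
open import Function.Base using (_∘_; id; flip)
open import Level using (0ℓ)
open import Relation.Binary.Core using (Rel)
open import Relation.Binary.Definitions using (WeaklyDecidable; tri<; tri≈; tri>)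
import Relation.Binary.Construct.StrictToNonStrict as ToNonStrict
open import Relation.Binary.PropositionalEquality.Core as ≡ using (_≡_)
import Relation.Binary.Reasoning.Setoid as SetoidReasoning
open import Relation.Binary.Structures using (IsStrictTotalOrder)
open import Relation.Nullary.Decidable using (Dec; does; yes; no; ¬?; _×-dec_; dec-true; dec-false; dec⇒maybe)
open import Relation.Nullary.Negation.Core using (¬_; contradiction)
open import Relation.Unary using (Pred; Decidable)

-- Write z = v + w with w = ρ exp (i φ), ∣ φ ∣ < π / n, and let g = exp (i ε) with
-- ε = (π - n φ) / 2.  All the angles ε + m φ, 0 ≤ m ≤ n, lie in (0, π), so
-- Im (g wᵐ) > 0, and z ^ (b + 1) = v z ^ b + w z ^ b propagates this to
-- Im (g wᶜ z ^ b) > 0 for c + b ≤ n.  Hence the numbers uᵢ = Im (g z ^ i) are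
-- positive and satisfy v uᵢ < uᵢ₊₁.  Since v ≥ 1 and
-- S_j^- ≤ S_j^+ v ^ (p_j - i) for n_j ≤ i ≤ N_j, the j-th positive run of
-- Im (g f(z)) = ∑ aᵢ uᵢ is at least S_j^+ u_{p_j}, which dominates the j-th
-- negative run; strictness comes from the leading term.
-- The powers of w are evaluated through exp (i x) exp (i y) = exp (i (x + y)),
-- proved by a Cauchy product, and sin > 0 on (0, π) because a sign change would
-- produce a smaller zero.

-- `IsCis` is only a relation between an angle and a value, so `g` has to be constructed as a limit,
-- and intermediate values of the sine have to exist before a sign change can produce a zero. Both
-- need a rate of convergence, hence natural numbers beyond given reals, whereas `complete` yields
-- such numbers only up to double negation. Two facts close this gap: the conclusion is a negation,
-- so one natural number above `1 / π` may be assumed, and the convergent series at `π` contained in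
-- `IsPi` then supplies all the others. Roots are relational as well: `v` bounds a root only after
-- that root has been shown to exist. This is why `x - y ^ m` passes through the same intermediate
-- value argument as the sine, and why that argument is stated for Lipschitz functions.

-- A ring solver with integer coefficients.

module IntegerCoefficientSolver {c ℓ} (R : CommutativeRing c ℓ) where
  open CommutativeRing R
  open TCOptimisedMult semiring using (×-homo-+; ×1-homo-*; 1+×) renaming (_×_ to _·_)
  open RingProperties ring using (-‿distribˡ-*; -‿distribʳ-*; -‿involutive; -0#≈0#; -‿+-comm)
  open SetoidReasoning setoid

  -- With the optimised multiple, `fromℤ (+ 1)` reduces to `1#` and `fromℤ (+ 2)` to `1# + 1#`, so
  -- the numerals `con (+ 1)` and `con (+ 2)` match the constants in the goals definitionally.
  fromℤ : ℤ → Carrier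
  fromℤ (ℤ.+ n)  = n · 1#
  fromℤ -[1+ n ] = - (suc n · 1#)

  fromℤ-neg : ∀ i → fromℤ (ℤ.- i) ≈ - fromℤ i
  fromℤ-neg (ℤ.+ zero) = sym -0#≈0#
  fromℤ-neg +[1+ n ]   = refl
  fromℤ-neg -[1+ n ]   = sym (-‿involutive _)

  fromℤ-⊖ : ∀ m n → fromℤ (m ⊖ n) ≈ m · 1# - n · 1#
  fromℤ-⊖ zero    zero    = sym (-‿inverseʳ 0#)
  fromℤ-⊖ zero    (suc n) = sym (+-identityˡ _)
  fromℤ-⊖ (suc m) zero    = sym (trans (+-congˡ -0#≈0#) (+-identityʳ _))
  fromℤ-⊖ (suc m) (suc n) = begin
    fromℤ (suc m ⊖ suc n)                  ≡⟨ ≡.cong fromℤ (ℤ.[1+m]⊖[1+n]≡m⊖n m n) ⟩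
    fromℤ (m ⊖ n)                          ≈⟨ fromℤ-⊖ m n ⟩
    m · 1# - n · 1#                        ≈⟨ +-congʳ (+-identityˡ _) ⟨
    0# + m · 1# - n · 1#                   ≈⟨ +-congʳ (+-congʳ (-‿inverseʳ 1#)) ⟨
    1# - 1# + m · 1# - n · 1#              ≈⟨ +-congʳ (+-assoc _ _ _) ⟩
    1# + (- 1# + m · 1#) - n · 1#          ≈⟨ +-congʳ (+-congˡ (+-comm _ _)) ⟩
    1# + (m · 1# - 1#) - n · 1#            ≈⟨ +-congʳ (+-assoc _ _ _) ⟨
    1# + m · 1# - 1# - n · 1#              ≈⟨ +-assoc _ _ _ ⟩
    1# + m · 1# + (- 1# - n · 1#)          ≈⟨ +-congˡ (-‿+-comm _ _) ⟩
    1# + m · 1# - (1# + n · 1#)            ≈⟨ +-cong (1+× m 1#) (-‿cong (1+× n 1#)) ⟨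
    suc m · 1# - suc n · 1#                ∎

  fromℤ-+ : ∀ i j → fromℤ (i ℤ.+ j) ≈ fromℤ i + fromℤ j
  fromℤ-+ (ℤ.+ m)  (ℤ.+ n)  = ×-homo-+ 1# m n
  fromℤ-+ (ℤ.+ m)  -[1+ n ] = fromℤ-⊖ m (suc n)
  fromℤ-+ -[1+ m ] (ℤ.+ n)  = trans (fromℤ-⊖ n (suc m)) (+-comm _ _)
  fromℤ-+ -[1+ m ] -[1+ n ] = begin
    - (suc (suc (m ℕ.+ n)) · 1#)         ≡⟨ ≡.cong (λ k → - (suc k · 1#)) (ℕ.+-suc m n) ⟨
    - ((suc m ℕ.+ suc n) · 1#)           ≈⟨ -‿cong (×-homo-+ 1# (suc m) (suc n)) ⟩
    - (suc m · 1# + suc n · 1#)          ≈⟨ -‿+-comm _ _ ⟨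
    - (suc m · 1#) - suc n · 1#          ∎

  fromℤ-* : ∀ i j → fromℤ (i ℤ.* j) ≈ fromℤ i * fromℤ j
  fromℤ-* (ℤ.+ m) (ℤ.+ n) = begin
    fromℤ (ℤ.+ m ℤ.* ℤ.+ n)  ≡⟨ ≡.cong fromℤ (ℤ.pos-* m n) ⟨
    (m ℕ.* n) · 1#           ≈⟨ ×1-homo-* m n ⟩
    (m · 1#) * (n · 1#)      ∎
  fromℤ-* (ℤ.+ m) -[1+ n ] = begin
    fromℤ (ℤ.+ m ℤ.* -[1+ n ])          ≡⟨ ≡.cong fromℤ (ℤ.neg-distribʳ-* (ℤ.+ m) +[1+ n ]) ⟨
    fromℤ (ℤ.- (ℤ.+ m ℤ.* +[1+ n ]))    ≈⟨ fromℤ-neg (ℤ.+ m ℤ.* +[1+ n ]) ⟩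
    - fromℤ (ℤ.+ m ℤ.* +[1+ n ])        ≈⟨ -‿cong (fromℤ-* (ℤ.+ m) +[1+ n ]) ⟩
    - (m · 1# * (suc n · 1#))           ≈⟨ -‿distribʳ-* _ _ ⟩
    m · 1# * - (suc n · 1#)             ∎
  fromℤ-* -[1+ m ] (ℤ.+ n) = begin
    fromℤ (-[1+ m ] ℤ.* ℤ.+ n)          ≡⟨ ≡.cong fromℤ (ℤ.neg-distribˡ-* +[1+ m ] (ℤ.+ n)) ⟨
    fromℤ (ℤ.- (+[1+ m ] ℤ.* ℤ.+ n))    ≈⟨ fromℤ-neg (+[1+ m ] ℤ.* ℤ.+ n) ⟩
    - fromℤ (+[1+ m ] ℤ.* ℤ.+ n)        ≈⟨ -‿cong (fromℤ-* +[1+ m ] (ℤ.+ n)) ⟩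
    - (suc m · 1# * (n · 1#))           ≈⟨ -‿distribˡ-* _ _ ⟩
    - (suc m · 1#) * (n · 1#)           ∎
  fromℤ-* -[1+ m ] -[1+ n ] = begin
    (suc m ℕ.* suc n) · 1#              ≈⟨ ×1-homo-* (suc m) (suc n) ⟩
    suc m · 1# * (suc n · 1#)           ≈⟨ -‿involutive _ ⟨
    - - (suc m · 1# * (suc n · 1#))     ≈⟨ -‿cong (-‿distribʳ-* _ _) ⟩
    - (suc m · 1# * - (suc n · 1#))     ≈⟨ -‿distribˡ-* _ _ ⟩
    - (suc m · 1#) * - (suc n · 1#)     ∎

  morphism : ℤ.+-*-rawRing -Raw-AlmostCommutative⟶ fromCommutativeRing R
  morphism = record
    { ⟦_⟧ = fromℤ ; +-homo = fromℤ-+ ; *-homo = fromℤ-* ; -‿homo = fromℤ-neg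
    ; 0-homo = refl ; 1-homo = refl }

  decEq : WeaklyDecidable (λ i j → fromℤ i ≈ fromℤ j)
  decEq i j = Maybe.map (λ i≡j → reflexive (≡.cong fromℤ i≡j)) (dec⇒maybe (i ℤ.≟ j))

  open Algebra.Solver.Ring ℤ.+-*-rawRing (fromCommutativeRing R) morphism decEq public
    using (solve; _:=_; _:+_; _:*_; _:-_; :-_; con)

-- Cauchy products and the addition theorem for exponential coefficients.

module Convolution {c ℓ} (R : CommutativeRing c ℓ) where
  open CommutativeRing R
  open SemiringSum semiring using (sum; sum-cong-≋; ∑-distrib-+; *-distribˡ-sum)
  open SemiringMult semiring using () renaming (_×_ to _·_)
  open IntegerCoefficientSolver R using (solve; _:=_; _:+_; _:*_; _:-_; :-_; con)
  open SetoidReasoning setoid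

  private
    natural : ℕ → Carrier
    natural m = m · 1#

  Σ : (ℕ → Carrier) → ℕ → Carrier
  Σ f m = sum {m} (f ∘ toℕ)

  Σ-cong : ∀ {f g} m → (∀ k → f k ≈ g k) → Σ f m ≈ Σ g m
  Σ-cong m f≈g = sum-cong-≋ {m} (λ i → f≈g (toℕ i))

  Σ-snoc : ∀ f m → Σ f (suc m) ≈ Σ f m + f m
  Σ-snoc f zero    = +-comm _ _
  Σ-snoc f (suc m) = trans (+-congˡ (Σ-snoc (f ∘ suc) m)) (sym (+-assoc (f 0) (Σ (f ∘ suc) m) (f (suc m))))

  -- The Cauchy product: `conv f g k` is the sum of `f i * g j` over `i + j = k`. Shifting `f`
  -- avoids subtraction on indices and makes induction on `k` structural.
  conv : (ℕ → Carrier) → (ℕ → Carrier) → ℕ → Carrier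
  conv f g zero    = f 0 * g 0
  conv f g (suc k) = f 0 * g (suc k) + conv (f ∘ suc) g k

  conv-cong : ∀ {f f′ g g′} k → (∀ i → f i ≈ f′ i) → (∀ i → g i ≈ g′ i) → conv f g k ≈ conv f′ g′ k
  conv-cong zero    f≈ g≈ = *-cong (f≈ 0) (g≈ 0)
  conv-cong (suc k) f≈ g≈ = +-cong (*-cong (f≈ 0) (g≈ (suc k))) (conv-cong k (f≈ ∘ suc) g≈)

  conv-+ˡ : ∀ f f′ g k → conv (λ i → f i + f′ i) g k ≈ conv f g k + conv f′ g k
  conv-+ˡ f f′ g zero    = distribʳ _ _ _
  conv-+ˡ f f′ g (suc k) = trans (+-congˡ (conv-+ˡ (f ∘ suc) (f′ ∘ suc) g k))
    (solve 5 (λ x y z u v → (x :+ y) :* z :+ (u :+ v) := (x :* z :+ u) :+ (y :* z :+ v)) refl _ _ _ _ _)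

  conv-*ˡ : ∀ x f g k → conv (λ i → x * f i) g k ≈ x * conv f g k
  conv-*ˡ x f g zero    = *-assoc _ _ _
  conv-*ˡ x f g (suc k) = trans (+-congˡ (conv-*ˡ x (f ∘ suc) g k))
    (solve 4 (λ x y z u → x :* y :* z :+ x :* u := x :* (y :* z :+ u)) refl _ _ _ _)

  conv-*ʳ : ∀ x f g k → conv f (λ i → x * g i) k ≈ x * conv f g k
  conv-*ʳ x f g zero    = solve 3 (λ x y z → y :* (x :* z) := x :* (y :* z)) refl _ _ _
  conv-*ʳ x f g (suc k) = trans (+-congˡ (conv-*ʳ x (f ∘ suc) g k))
    (solve 4 (λ x y z u → y :* (x :* z) :+ x :* u := x :* (y :* z :+ u)) refl _ _ _ _)

  conv-sucˡ : ∀ {f} g k → f 0 ≈ 0# → conv f g (suc k) ≈ conv (f ∘ suc) g k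
  conv-sucˡ g k f0≈0 = trans (+-congʳ (trans (*-congʳ f0≈0) (zeroˡ _))) (+-identityˡ _)

  conv-sucʳ : ∀ f {g} k → g 0 ≈ 0# → conv f g (suc k) ≈ conv f (g ∘ suc) k
  conv-sucʳ f zero    g0≈0 = trans (+-congˡ (trans (*-congˡ g0≈0) (zeroʳ _))) (+-identityʳ _)
  conv-sucʳ f (suc k) g0≈0 = +-congˡ (conv-sucʳ (f ∘ suc) k g0≈0)

  euler : (ℕ → Carrier) → ℕ → Carrier
  euler f k = natural k * f k

  -- The Euler operator x d/dx is a derivation of power series.
  conv-euler : ∀ f g k → natural k * conv f g k ≈ conv (euler f) g k + conv f (euler g) k
  conv-euler f g zero    = solve 2 (λ x y → con (+ 0) :* (x :* y) := con (+ 0) :* x :* y :+ x :*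
    (con (+ 0) :* y)) refl (f 0) (g 0)
  conv-euler f g (suc k) = begin
    natural (suc k) * (f 0 * g (suc k) + conv f⁺ g k)
      ≈⟨ solve 4 (λ m x y u → (con (+ 1) :+ m) :* (x :* y :+ u) := (u :+ m :* u) :+ x :*
        ((con (+ 1) :+ m) :* y)) refl _ _ _ _ ⟩
    conv f⁺ g k + natural k * conv f⁺ g k + f 0 * euler g (suc k)
      ≈⟨ +-congʳ (+-congˡ (conv-euler f⁺ g k)) ⟩
    conv f⁺ g k + (conv (euler f⁺) g k + conv f⁺ (euler g) k) + f 0 * euler g (suc k)
      ≈⟨ solve 4 (λ u v w t → u :+ (v :+ w) :+ t := (u :+ v) :+ (t :+ w)) refl _ _ _ _ ⟩
    conv f⁺ g k + conv (euler f⁺) g k + conv f (euler g) (suc k)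
      ≈⟨ +-congʳ (conv-+ˡ f⁺ (euler f⁺) g k) ⟨
    conv (λ i → f⁺ i + euler f⁺ i) g k + conv f (euler g) (suc k)
      ≈⟨ +-congʳ (conv-cong {g = g} k (λ i → solve 2 (λ m x → x :+ m :* x := (con (+ 1) :+ m) :* x) refl _ _)
        (λ _ → refl)) ⟩
    conv (euler f ∘ suc) g k + conv f (euler g) (suc k)
      ≈⟨ +-congʳ (conv-sucˡ {euler f} g k (zeroˡ _)) ⟨
    conv (euler f) g (suc k) + conv f (euler g) (suc k) ∎
    where f⁺ = f ∘ suc

  -- The coefficient sequence x ^ k / k !, without division.
  IsExpSequence : Carrier → (ℕ → Carrier) → Set _
  IsExpSequence x f = f 0 ≈ 1# × (∀ k → natural (suc k) * f (suc k) ≈ x * f k)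

  -- The recursion in `IsExpSequence` is the differential equation of the exponential. Since the
  -- Euler operator is a derivation, a product of solutions for `x` and `y` solves the equation for
  -- `x + y`; this replaces the binomial theorem.
  conv-expSequence : ∀ {x y f g} → IsExpSequence x f → IsExpSequence y g → IsExpSequence (x + y) (conv f g)
  conv-expSequence {x} {y} {f} {g} (f0 , f⁺) (g0 , g⁺) = trans (*-cong f0 g0) (*-identityˡ 1#) , λ k → begin
    natural (suc k) * conv f g (suc k)                        ≈⟨ conv-euler f g (suc k) ⟩
    conv (euler f) g (suc k) + conv f (euler g) (suc k)       ≈⟨ +-cong (conv-sucˡ {euler f} g k (zeroˡ _))
      (conv-sucʳ f {euler g} k (zeroˡ _)) ⟩
    conv (euler f ∘ suc) g k + conv f (euler g ∘ suc) k       ≈⟨ +-cong (conv-cong {g = g} k f⁺ (λ _ → refl))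
      (conv-cong {f} k (λ _ → refl) g⁺) ⟩
    conv (λ i → x * f i) g k + conv f (λ i → y * g i) k       ≈⟨ +-cong (conv-*ˡ x f g k) (conv-*ʳ y f g k) ⟩
    x * conv f g k + y * conv f g k                           ≈⟨ distribʳ _ x y ⟨
    (x + y) * conv f g k                                      ∎

  -- The triangle of index pairs `i + j ≤ m` is cut into its row `i = 0` and a smaller triangle for
  -- the shifted `f`. The estimates for Cauchy products are inductions along this cut.
  Σ-conv-suc : ∀ f g m → Σ (conv f g) (suc m) ≈ f 0 * Σ g (suc m) + Σ (conv (f ∘ suc) g) m
  Σ-conv-suc f g m = begin
    f 0 * g 0 + Σ (λ k → f 0 * g (suc k) + conv (f ∘ suc) g k) m
      ≈⟨ +-congˡ (∑-distrib-+ {m} (λ i → f 0 * g (suc (toℕ i))) (λ i → conv (f ∘ suc) g (toℕ i))) ⟩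
    f 0 * g 0 + (Σ (λ k → f 0 * g (suc k)) m + Σ (conv (f ∘ suc) g) m)
      ≈⟨ +-congˡ (+-congʳ (*-distribˡ-sum {m} (f 0) (λ i → g (suc (toℕ i))))) ⟨
    f 0 * g 0 + (f 0 * Σ (g ∘ suc) m + Σ (conv (f ∘ suc) g) m)
      ≈⟨ solve 4 (λ x y u v → x :* y :+ (x :* u :+ v) := x :* (y :+ u) :+ v) refl _ _ _ _ ⟩
    f 0 * Σ g (suc m) + Σ (conv (f ∘ suc) g) m ∎

-- Ordered field arithmetic, bounds and intermediate values.

module OrderedField (ℝ : CompleteOrderedField) where
  open Real ℝ
  open IntegerCoefficientSolver commutativeRing using (solve; _:=_; _:+_; _:*_; _:-_; :-_; con) public

  module STO = IsStrictTotalOrder isStrictTotalOrder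
  open STO public using () renaming
    (trans to <-trans; <-respʳ-≈ to <-respʳ; <-respˡ-≈ to <-respˡ; irrefl to <-irrefl; asym to <-asym)

  2# : Carrier
  2# = 1# + 1#

  <⇒≤ : ∀ {x y} → x < y → x ≤ y
  <⇒≤ = inj₁

  ≤-reflexive : ∀ {x y} → x ≈ y → x ≤ y
  ≤-reflexive = inj₂

  ≤-refl : ∀ {x} → x ≤ x
  ≤-refl = inj₂ refl

  ≤-trans : ∀ {x y z} → x ≤ y → y ≤ z → x ≤ z
  ≤-trans = ToNonStrict.trans _≈_ _<_ isEquivalence STO.<-resp-≈ <-trans

  ≤-antisym : ∀ {x y} → x ≤ y → y ≤ x → x ≈ y
  ≤-antisym = ToNonStrict.antisym _≈_ _<_ isEquivalence <-trans <-irrefl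

  <-≤-trans : ∀ {x y z} → x < y → y ≤ z → x < z
  <-≤-trans = ToNonStrict.<-≤-trans _≈_ _<_ <-trans <-respʳ

  ≤-<-trans : ∀ {x y z} → x ≤ y → y < z → x < z
  ≤-<-trans (inj₁ x<y) y<z = <-trans x<y y<z
  ≤-<-trans (inj₂ x≈y) y<z = <-respˡ (sym x≈y) y<z

  ≤-respˡ : ∀ {x x′ y} → x ≈ x′ → x ≤ y → x′ ≤ y
  ≤-respˡ x≈x′ = ≤-trans (inj₂ (sym x≈x′))

  ≤-respʳ : ∀ {x y y′} → y ≈ y′ → x ≤ y → x ≤ y′
  ≤-respʳ y≈y′ x≤y = ≤-trans x≤y (inj₂ y≈y′)

  ≤⇒≯ : ∀ {x y} → x ≤ y → ¬ y < x
  ≤⇒≯ x≤y y<x = <-irrefl refl (<-≤-trans y<x x≤y)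

  ≮⇒≥ : ∀ {x y} → ¬ x < y → y ≤ x
  ≮⇒≥ {x} {y} x≮y with compare x y
  ... | tri< x<y _ _ = contradiction x<y x≮y
  ... | tri≈ _ x≈y _ = inj₂ (sym x≈y)
  ... | tri> _ _ y<x = inj₁ y<x

  ≤∨> : ∀ x y → x ≤ y ⊎ y < x
  ≤∨> x y with compare x y
  ... | tri< x<y _ _ = inj₁ (inj₁ x<y)
  ... | tri≈ _ x≈y _ = inj₁ (inj₂ x≈y)
  ... | tri> _ _ y<x = inj₂ y<x

  x<y⇒0<y-x : ∀ {x y} → x < y → 0# < y - x
  x<y⇒0<y-x {x} {y} x<y = <-respˡ (-‿inverseˡ x) (<-respʳ (+-comm (- x) y) (+-monoʳ-< (- x) x<y))

  x≤y⇒0≤y-x : ∀ {x y} → x ≤ y → 0# ≤ y - x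
  x≤y⇒0≤y-x         (inj₁ x<y) = inj₁ (x<y⇒0<y-x x<y)
  x≤y⇒0≤y-x {x} {y} (inj₂ x≈y) = inj₂ (trans (sym (-‿inverseʳ x)) (+-congʳ x≈y))

  -- Inequalities are proved by displaying the difference as a visibly positive
  -- or non-negative expression and leaving the identity to the ring solver.
  <-by : ∀ {x y t} → 0# < t → y - x ≈ t → x < y
  <-by {x} {y} {t} 0<t y-x≈t =
    <-respˡ (+-identityʳ x) (<-respʳ x+t≈y (+-monoʳ-< x 0<t))
    where
    x+t≈y : x + t ≈ y
    x+t≈y = trans (+-congˡ (sym y-x≈t)) (solve 2 (λ x y → x :+ (y :- x) := y) refl x y)

  ≤-by : ∀ {x y t} → 0# ≤ t → y - x ≈ t → x ≤ y
  ≤-by {x} {y} (inj₁ 0<t) y-x≈t = inj₁ (<-by 0<t y-x≈t)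
  ≤-by {x} {y} (inj₂ 0≈t) y-x≈t = inj₂ (trans (sym (+-identityˡ x))
    (trans (+-congʳ (trans 0≈t (sym y-x≈t))) (solve 2 (λ x y → y :- x :+ x := y) refl x y)))

  0<+ : ∀ {x y} → 0# < x → 0# ≤ y → 0# < x + y
  0<+ {x} 0<x (inj₁ 0<y) = <-trans 0<x (<-respˡ (+-identityʳ x) (+-monoʳ-< x 0<y))
  0<+ {x} 0<x (inj₂ 0≈y) = <-respʳ (trans (sym (+-identityʳ x)) (+-congˡ 0≈y)) 0<x

  0≤+ : ∀ {x y} → 0# ≤ x → 0# ≤ y → 0# ≤ x + y
  0≤+ (inj₁ 0<x) 0≤y = inj₁ (0<+ 0<x 0≤y)
  0≤+ (inj₂ 0≈x) 0≤y = ≤-respʳ (trans (sym (+-identityˡ _)) (+-congʳ 0≈x)) 0≤y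

  0≤* : ∀ {x y} → 0# ≤ x → 0# ≤ y → 0# ≤ x * y
  0≤* (inj₁ 0<x) (inj₁ 0<y) = inj₁ (*-pos 0<x 0<y)
  0≤* {x} {y} (inj₂ 0≈x) _  = inj₂ (trans (sym (zeroˡ y)) (*-congʳ 0≈x))
  0≤* {x} {y} _ (inj₂ 0≈y)  = inj₂ (trans (sym (zeroʳ x)) (*-congˡ 0≈y))

  0<⇒≉0 : ∀ {x} → 0# < x → ¬ x ≈ 0#
  0<⇒≉0 0<x x≈0 = <-irrefl (sym x≈0) 0<x

  +-mono-≤ : ∀ {x y u v} → x ≤ y → u ≤ v → x + u ≤ y + v
  +-mono-≤ {x} {y} {u} {v} x≤y u≤v = ≤-by (0≤+ (x≤y⇒0≤y-x x≤y) (x≤y⇒0≤y-x u≤v))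
    (solve 4 (λ x y u v → y :+ v :- (x :+ u) := (y :- x) :+ (v :- u)) refl x y u v)

  *-monoˡ-≤ : ∀ {x y z} → 0# ≤ z → x ≤ y → z * x ≤ z * y
  *-monoˡ-≤ {x} {y} {z} 0≤z x≤y = ≤-by (0≤* 0≤z (x≤y⇒0≤y-x x≤y))
    (solve 3 (λ x y z → z :* y :- z :* x := z :* (y :- x)) refl x y z)

  *-monoʳ-≤ : ∀ {x y z} → 0# ≤ z → x ≤ y → x * z ≤ y * z
  *-monoʳ-≤ {x} {y} {z} 0≤z x≤y = ≤-respˡ (*-comm z x) (≤-respʳ (*-comm z y) (*-monoˡ-≤ 0≤z x≤y))

  *-monoˡ-< : ∀ {x y z} → 0# < z → x < y → z * x < z * y
  *-monoˡ-< {x} {y} {z} 0<z x<y = <-by (*-pos 0<z (x<y⇒0<y-x x<y))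
    (solve 3 (λ x y z → z :* y :- z :* x := z :* (y :- x)) refl x y z)

  *-mono-≤ : ∀ {x y u v} → 0# ≤ x → 0# ≤ v → x ≤ y → u ≤ v → x * u ≤ y * v
  *-mono-≤ 0≤x 0≤v x≤y u≤v = ≤-trans (*-monoˡ-≤ 0≤x u≤v) (*-monoʳ-≤ 0≤v x≤y)

  *-cancelˡ-≤ : ∀ {x y z} → 0# < z → z * x ≤ z * y → x ≤ y
  *-cancelˡ-≤ {x} {y} 0<z zx≤zy with ≤∨> x y
  ... | inj₁ x≤y = x≤y
  ... | inj₂ y<x = ⊥-elim (≤⇒≯ zx≤zy (*-monoˡ-< 0<z y<x))

  *-cancelˡ-< : ∀ {x y z} → 0# < z → z * x < z * y → x < y
  *-cancelˡ-< {x} {y} 0<z zx<zy with ≤∨> y x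
  ... | inj₁ y≤x = ⊥-elim (≤⇒≯ (*-monoˡ-≤ (<⇒≤ 0<z) y≤x) zx<zy)
  ... | inj₂ x<y = x<y

  neg-mono-≤ : ∀ {x y} → x ≤ y → - y ≤ - x
  neg-mono-≤ {x} {y} x≤y = ≤-by (x≤y⇒0≤y-x x≤y)
    (solve 2 (λ x y → :- x :- :- y := y :- x) refl x y)

  neg-mono-< : ∀ {x y} → x < y → - y < - x
  neg-mono-< {x} {y} x<y = <-by (x<y⇒0<y-x x<y)
    (solve 2 (λ x y → :- x :- :- y := y :- x) refl x y)

  0≤x*x : ∀ x → 0# ≤ x * x
  0≤x*x x with ≤∨> 0# x
  ... | inj₁ 0≤x = 0≤* 0≤x 0≤x
  ... | inj₂ x<0 = ≤-respʳ (solve 1 (λ x → (con (+ 0) :- x) :* (con (+ 0) :- x) := x :* x) refl x)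
                     (0≤* (x≤y⇒0≤y-x (<⇒≤ x<0)) (x≤y⇒0≤y-x (<⇒≤ x<0)))

  0<1 : 0# < 1#
  0<1 with compare 0# 1#
  ... | tri< 0<1 _ _ = 0<1
  ... | tri≈ _ 0≈1 _ = contradiction (sym 0≈1) 1≉0
  ... | tri> _ _ 1<0 = ⊥-elim (≤⇒≯ (≤-respʳ (*-identityˡ 1#) (0≤x*x 1#)) 1<0)

  0≤1 : 0# ≤ 1#
  0≤1 = <⇒≤ 0<1

  0<2 : 0# < 2#
  0<2 = 0<+ 0<1 0≤1

  0<⁻¹ : ∀ {x} → 0# < x → 0# < x ⁻¹
  0<⁻¹ {x} 0<x with ≤∨> (x ⁻¹) 0#
  ... | inj₂ 0<x⁻¹ = 0<x⁻¹
  ... | inj₁ x⁻¹≤0 = ⊥-elim (≤⇒≯ 1≤0 0<1)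
    where
    1≤0 : 1# ≤ 0#
    1≤0 = ≤-respˡ (⁻¹-inverseʳ x (0<⇒≉0 0<x)) (≤-respʳ (zeroʳ x) (*-monoˡ-≤ (<⇒≤ 0<x) x⁻¹≤0))

  */-cancel : ∀ {x y} → 0# < y → y * (x / y) ≈ x
  */-cancel {x} {y} 0<y = trans (solve 3 (λ x y i → y :* (x :* i) := y :* i :* x) refl x y (y ⁻¹))
    (trans (*-congʳ (⁻¹-inverseʳ y (0<⇒≉0 0<y))) (*-identityˡ x))

  0</ : ∀ {x y} → 0# < x → 0# < y → 0# < x / y
  0</ 0<x 0<y = *-pos 0<x (0<⁻¹ 0<y)

  *-cancelˡ-≈ : ∀ {x y z} → 0# < z → z * x ≈ z * y → x ≈ y
  *-cancelˡ-≈ 0<z zx≈zy = ≤-antisym (*-cancelˡ-≤ 0<z (inj₂ zx≈zy)) (*-cancelˡ-≤ 0<z (inj₂ (sym zx≈zy)))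

  ^-nonneg : ∀ {x} n → 0# ≤ x → 0# ≤ x ^ n
  ^-nonneg zero    0≤x = 0≤1
  ^-nonneg (suc n) 0≤x = 0≤* 0≤x (^-nonneg n 0≤x)

  1^ : ∀ m → 1# ^ m ≈ 1#
  1^ zero    = refl
  1^ (suc m) = trans (*-identityˡ _) (1^ m)

  ^-pos : ∀ {x} n → 0# < x → 0# < x ^ n
  ^-pos zero    0<x = 0<1
  ^-pos (suc n) 0<x = *-pos 0<x (^-pos n 0<x)

  ^-mono-≤ : ∀ {x y} n → 0# ≤ x → x ≤ y → x ^ n ≤ y ^ n
  ^-mono-≤ zero    0≤x x≤y = ≤-refl
  ^-mono-≤ (suc n) 0≤x x≤y = *-mono-≤ 0≤x (^-nonneg n (≤-trans 0≤x x≤y)) x≤y (^-mono-≤ n 0≤x x≤y)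

  fromNat-nonneg : ∀ n → 0# ≤ fromNat n
  fromNat-nonneg zero    = ≤-refl
  fromNat-nonneg (suc n) = 0≤+ 0≤1 (fromNat-nonneg n)

  fromNat-pos : ∀ n → 0# < fromNat (suc n)
  fromNat-pos n = 0<+ 0<1 (fromNat-nonneg n)

  fromNat-mono-≤ : ∀ {m n} → m ℕ.≤ n → fromNat m ≤ fromNat n
  fromNat-mono-≤ {n = n} ℕ.z≤n = fromNat-nonneg n
  fromNat-mono-≤ (ℕ.s≤s m≤n)   = +-mono-≤ ≤-refl (fromNat-mono-≤ m≤n)

  -- This is ∣ x ∣ ≤ r without a case distinction on the sign of x.
  Bounded : Carrier → Carrier → Set
  Bounded x r = - r ≤ x × x ≤ r

  bounded-0 : Bounded 0# 0#
  bounded-0 = ≤-reflexive (solve 0 (:- con (+ 0) := con (+ 0)) refl) , ≤-refl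

  bounded-nonneg : ∀ {x r} → Bounded x r → 0# ≤ r
  bounded-nonneg {x} {r} (-r≤x , x≤r) = *-cancelˡ-≤ 0<2 (≤-by (0≤+ (x≤y⇒0≤y-x -r≤x) (x≤y⇒0≤y-x x≤r))
    (solve 2 (λ x r → con (+ 2) :* r :- con (+ 2) :* con (+ 0) := x :- :- r :+ (r :- x)) refl x r))

  nonneg⇒bounded : ∀ {x r} → 0# ≤ x → x ≤ r → Bounded x r
  nonneg⇒bounded {x} {r} 0≤x x≤r = ≤-by (0≤+ 0≤x (≤-trans 0≤x x≤r))
    (solve 2 (λ x r → x :- :- r := x :+ r) refl x r) , x≤r

  bounded-resp : ∀ {x y r} → x ≈ y → Bounded x r → Bounded y r
  bounded-resp x≈y (l , u) = ≤-respʳ x≈y l , ≤-respˡ x≈y u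

  bounded-weaken : ∀ {x r s} → r ≤ s → Bounded x r → Bounded x s
  bounded-weaken r≤s (l , u) = ≤-trans (neg-mono-≤ r≤s) l , ≤-trans u r≤s

  bounded-neg : ∀ {x r} → Bounded x r → Bounded (- x) r
  bounded-neg {x} {r} (l , u) = neg-mono-≤ u , ≤-respʳ (solve 1 (λ r → :- :- r := r) refl r) (neg-mono-≤ l)

  bounded-+ : ∀ {x y r s} → Bounded x r → Bounded y s → Bounded (x + y) (r + s)
  bounded-+ {r = r} {s} (l , u) (l′ , u′) =
    ≤-respˡ (solve 2 (λ r s → :- r :+ :- s := :- (r :+ s)) refl r s) (+-mono-≤ l l′) , +-mono-≤ u u′

  -- The slacks `r - x`, `r + x`, `s - y`, `s + y` are non-negative. Two of their products add up to
  -- `2 (r s + x y)` and the two mixed ones to `2 (r s - x y)`, which avoids any case distinction on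
  -- signs.
  bounded-* : ∀ {x y r s} → Bounded x r → Bounded y s → Bounded (x * y) (r * s)
  bounded-* {x} {y} {r} {s} (l , u) (l′ , u′) =
    *-cancelˡ-≤ 0<2 (≤-by (0≤+ (0≤* (x≤y⇒0≤y-x u) (x≤y⇒0≤y-x u′)) (0≤* (x≤y⇒0≤y-x l) (x≤y⇒0≤y-x l′)))
      (solve 4 (λ x y r s → con (+ 2) :* (x :* y) :- con (+ 2) :* (:- (r :* s)) :=
         (r :- x) :* (s :- y) :+ (x :- :- r) :* (y :- :- s)) refl x y r s)) ,
    *-cancelˡ-≤ 0<2 (≤-by (0≤+ (0≤* (x≤y⇒0≤y-x u) (x≤y⇒0≤y-x l′)) (0≤* (x≤y⇒0≤y-x l) (x≤y⇒0≤y-x u′)))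
      (solve 4 (λ x y r s → con (+ 2) :* (r :* s) :- con (+ 2) :* (x :* y) :=
         (r :- x) :* (y :- :- s) :+ (x :- :- r) :* (s :- y)) refl x y r s))

  sq<⇒bounded : ∀ {x y ε} → 0# < ε → x * x + y * y < ε * ε → Bounded x ε
  sq<⇒bounded {x} {y} {ε} 0<ε sq< = lower , upper
    where
    upper : x ≤ ε
    upper with ≤∨> x ε
    ... | inj₁ x≤ε = x≤ε
    ... | inj₂ ε<x = ⊥-elim (≤⇒≯
      (≤-by (0≤+ (0≤* (x≤y⇒0≤y-x (<⇒≤ ε<x)) (0≤+ (<⇒≤ 0<ε) (<⇒≤ (<-trans 0<ε ε<x)))) (0≤x*x y))
      (solve 3 (λ x y ε → x :* x :+ y :* y :- ε :* ε := (x :- ε) :* (ε :+ x) :+ y :* y) refl x y ε)) sq<)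
    lower : - ε ≤ x
    lower with ≤∨> (- ε) x
    ... | inj₁ -ε≤x = -ε≤x
    ... | inj₂ x<-ε = ⊥-elim (≤⇒≯
      (≤-by (0≤+ (0≤* (x≤y⇒0≤y-x (<⇒≤ x<-ε)) (0≤+ (<⇒≤ 0<ε) (0≤+ (<⇒≤ 0<ε) (x≤y⇒0≤y-x (<⇒≤ x<-ε))))) (0≤x*x y))
      (solve 3 (λ x y ε → x :* x :+ y :* y :- ε :* ε := (:- ε :- x) :*
        (ε :+ (ε :+ (:- ε :- x))) :+ y :* y) refl x y ε)) sq<)

  -- If no natural number exceeded `x`, the natural numbers would have a supremum `b`; but `b - 1`
  -- would bound them too, because `1 + n` is again a natural number.
  ¬¬archimedean : ∀ x → ¬ ¬ (∃[ n ] x < fromNat n)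
  ¬¬archimedean x unbounded with complete P (0# , 0 , refl)
    (x , λ { y (n , y≈n) → ≤-respˡ (sym y≈n) (≮⇒≥ (λ x<n → unbounded (n , x<n))) })
    where
    P : Carrier → Set
    P y = ∃[ n ] y ≈ fromNat n
  ... | b , ub , least = ≤⇒≯ (least (b - 1#) λ { y (n , y≈n) → ≤-by (x≤y⇒0≤y-x (ub (1# + fromNat n) (suc n , refl)))
            (trans (+-congˡ (-‿cong y≈n)) (solve 2 (λ b m → b :- con (+ 1) :- m := b :- (con (+ 1) :+ m)) refl b
              (fromNat n))) })
          (<-by 0<1 (solve 1 (λ b → b :- (b :- con (+ 1)) := con (+ 1)) refl b))

  -- The Lipschitz bound forces the value of f to be independent of the domain
  -- proofs, so f need not be extended to all of ℝ.
  intermediate-value :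
    ∀ {lo hi L} (f : ∀ x → lo ≤ x → x ≤ hi → Carrier) → 0# < L →
    (∀ {x y} (lx : lo ≤ x) (xh : x ≤ hi) (ly : lo ≤ y) (yh : y ≤ hi) → x ≤ y →
       Bounded (f x lx xh - f y ly yh) (L * (y - x))) →
    (lo≤hi : lo ≤ hi) → 0# < f lo ≤-refl lo≤hi → f hi lo≤hi ≤-refl ≤ 0# →
    ∃[ x ] ∃[ lx ] ∃[ xh ] (f x lx xh ≈ 0#)
  intermediate-value {lo} {hi} {L} f 0<L lipschitz lo≤hi f[lo]>0 f[hi]≤0 =
    b , lo≤b , b≤hi , f[b]≈0
    where
    P : Carrier → Set
    P x = ∃[ lx ] ∃[ xh ] (0# < f x lx xh)
    P[lo] : P lo
    P[lo] = ≤-refl , lo≤hi , f[lo]>0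
    supremum = complete P (lo , P[lo]) (hi , λ { _ (_ , xh , _) → xh })
    b = proj₁ supremum
    ub : IsUpperBound P b
    ub = proj₁ (proj₂ supremum)
    least : ∀ c → IsUpperBound P c → b ≤ c
    least = proj₂ (proj₂ supremum)
    lo≤b : lo ≤ b
    lo≤b = ub lo P[lo]
    b≤hi : b ≤ hi
    b≤hi = least hi (λ { _ (_ , xh , _) → xh })

    -- Taking `δ = t / (2 L)` gives `L δ = t / 2`: moving by at most `δ` changes `f` by less than
    -- `t`.
    step : ∀ t → 0# < t → ∃[ δ ] (0# < δ × L * δ < t)
    step t 0<t = t / (2# * L) , 0</ 0<t 0<2L ,
      <-by (*-pos 0<L (0</ 0<t 0<2L)) (trans (+-congʳ (sym (*/-cancel 0<2L)))
        (solve 2 (λ L d → con (+ 2) :* L :* d :- L :* d := L :* d) refl L (t / (2# * L))))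
      where
      0<2L : 0# < 2# * L
      0<2L = *-pos 0<2 0<L

    f[b]≈0 : f b lo≤b b≤hi ≈ 0#
    f[b]≈0 with compare (f b lo≤b b≤hi) 0#
    ... | tri≈ _ f[b]≈0 _ = f[b]≈0
    ... | tri> _ _ 0<f[b] = ⊥-elim (≤⇒≯ (ub y (≤-trans lo≤b b≤y , y≤hi , 0<f[y])) b<y)
      where
      δ-step = step _ 0<f[b]
      δ = proj₁ δ-step
      0<δ = proj₁ (proj₂ δ-step)
      y = b + δ
      y-b : y - b ≈ δ
      y-b = solve 2 (λ b d → b :+ d :- b := d) refl b δ
      b<y : b < y
      b<y = <-by 0<δ y-b
      b≤y = <⇒≤ b<y
      -- If `hi` were closer to `b` than `δ`, then `f hi ≤ 0` would force
      -- `f b ≤ L (hi - b) ≤ L δ < f b`.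
      y≤hi : y ≤ hi
      y≤hi with ≤∨> y hi
      ... | inj₁ y≤hi = y≤hi
      ... | inj₂ hi<y = ⊥-elim (≤⇒≯ (≤-trans f[b]≤ (≤-trans (*-monoˡ-≤ (<⇒≤ 0<L) hi-b≤δ) ≤-refl))
        (proj₂ (proj₂ δ-step)))
        where
        hi-b≤δ : hi - b ≤ δ
        hi-b≤δ = ≤-by (x≤y⇒0≤y-x (<⇒≤ hi<y)) (solve 3 (λ b d h → d :- (h :- b) := b :+ d :- h) refl b δ hi)
        f[b]≤ : f b lo≤b b≤hi ≤ L * (hi - b)
        f[b]≤ = ≤-trans (≤-by (x≤y⇒0≤y-x f[hi]≤0)
                  (solve 2 (λ p q → p :- q :- p := con (+ 0) :- q) refl (f b lo≤b b≤hi) (f hi lo≤hi ≤-refl)))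
                (proj₂ (lipschitz lo≤b b≤hi lo≤hi ≤-refl b≤hi))
      0<f[y] : 0# < f y (≤-trans lo≤b b≤y) y≤hi
      0<f[y] = <-by (0<+ (x<y⇒0<y-x (proj₂ (proj₂ δ-step)))
          (x≤y⇒0≤y-x (≤-respʳ (*-congˡ y-b) (proj₂ (lipschitz lo≤b b≤hi (≤-trans lo≤b b≤y) y≤hi b≤y)))))
        (solve 3 (λ p q e → q :- con (+ 0) := p :- e :+ (e :- (p :- q))) refl (f b lo≤b b≤hi)
          (f y (≤-trans lo≤b b≤y) y≤hi) (L * δ))
    -- With `f b` negative, `f` is still negative on the last stretch of length `δ` below `b`, so
    -- `b - δ` would already be an upper bound.
    ... | tri< f[b]<0 _ _ = ⊥-elim
      (≤⇒≯ (least (b - δ) b-δ-ub) (<-by 0<δ (solve 2 (λ b d → b :- (b :- d) := d) refl b δ)))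
      where
      δ-step = step (0# - f b lo≤b b≤hi) (x<y⇒0<y-x f[b]<0)
      δ = proj₁ δ-step
      0<δ = proj₁ (proj₂ δ-step)
      b-δ-ub : IsUpperBound P (b - δ)
      b-δ-ub x (lx , xh , 0<f[x]) with ≤∨> x (b - δ)
      ... | inj₁ x≤b-δ = x≤b-δ
      ... | inj₂ b-δ<x = ⊥-elim (≤⇒≯
        (≤-trans (≤-trans -f[b]≤ (proj₂ (lipschitz lx xh lo≤b b≤hi (ub x (lx , xh , 0<f[x])))))
                                     (*-monoˡ-≤ (<⇒≤ 0<L) b-x≤δ)) (proj₂ (proj₂ δ-step)))
        where
        b-x≤δ : b - x ≤ δ
        b-x≤δ = ≤-by (x≤y⇒0≤y-x (<⇒≤ b-δ<x)) (solve 3 (λ b d x → d :- (b :- x) := x :- (b :- d)) refl b δ x)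
        -f[b]≤ : 0# - f b lo≤b b≤hi ≤ f x lx xh - f b lo≤b b≤hi
        -f[b]≤ = +-mono-≤ (<⇒≤ 0<f[x]) ≤-refl

  -- From `y * y ^ m - x * x ^ m = (y - x) * y ^ m + x * (y ^ m - x ^ m)` the constant `Q ^ m + Q *
  -- L` would do; the additional `L` keeps it positive even for `Q = 0`.
  ^-lipschitz : ∀ {Q} m → 0# ≤ Q → ∃[ L ]
    (0# < L × (∀ {x y} → 0# ≤ x → x ≤ y → y ≤ Q → y ^ m - x ^ m ≤ L * (y - x)))
  ^-lipschitz zero 0≤Q = 1# , 0<1 , λ {x} {y} _ x≤y _ → ≤-by (x≤y⇒0≤y-x x≤y)
    (solve 2 (λ x y → con (+ 1) :* (y :- x) :- (con (+ 1) :- con (+ 1)) := y :- x) refl x y)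
  ^-lipschitz {Q} (suc m) 0≤Q with ^-lipschitz m 0≤Q
  ... | L , 0<L , lip = Q ^ m + (1# + Q) * L , 0<L′ , λ {x} {y} 0≤x x≤y y≤Q →
      let 0≤y-x = x≤y⇒0≤y-x x≤y in
      ≤-by (0≤+ (0≤+ (0≤* (x≤y⇒0≤y-x (^-mono-≤ m (≤-trans 0≤x x≤y) y≤Q)) 0≤y-x)
                     (0≤* 0≤x (x≤y⇒0≤y-x (lip 0≤x x≤y y≤Q))))
                (0≤* (0≤* (0≤+ 0≤1 (x≤y⇒0≤y-x (≤-trans x≤y y≤Q))) (<⇒≤ 0<L)) 0≤y-x))
        (solve 7 (λ x y p q r Q L → (r :+ (con (+ 1) :+ Q) :* L) :* (y :- x) :- (y :* q :- x :* p) :=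
          (r :- q) :* (y :- x) :+ x :* (L :* (y :- x) :- (q :- p)) :+ (con (+ 1) :+ (Q :- x)) :* L :* (y :- x))
          refl x y (x ^ m) (y ^ m) (Q ^ m) Q L)
    where
    0<L′ : 0# < Q ^ m + (1# + Q) * L
    0<L′ = <-respʳ (+-comm _ _) (0<+ (*-pos (0<+ 0<1 0≤Q) 0<L) (^-nonneg m 0≤Q))

-- The ring of complex numbers, majorants and the exponential series.

module ExponentialSeries (ℝ : CompleteOrderedField) where
  open Real ℝ
  open Complex ℝ
  open OrderedField ℝ
  open SemiringMult semiring using (×1-homo-*)

  ℂ-commutativeRing : CommutativeRing 0ℓ 0ℓ
  ℂ-commutativeRing = record
    { Carrier = ℂ
    ; _≈_ = _≈ℂ_
    ; _+_ = _+ℂ_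
    ; _*_ = _*ℂ_
    ; -_ = -ℂ_
    ; 0# = 0ℂ
    ; 1# = 1ℂ
    ; isCommutativeRing = record
      { isRing = record
        { +-isAbelianGroup = record
          { isGroup = record
            { isMonoid = record
              { isSemigroup = record
                { isMagma = record
                  { isEquivalence = record
                    { refl = refl , refl
                    ; sym = λ (p , q) → sym p , sym q
                    ; trans = λ (p , q) (p′ , q′) → trans p p′ , trans q q′
                    }
                  ; ∙-cong = λ (p , q) (p′ , q′) → +-cong p p′ , +-cong q q′
                  }
                ; assoc = λ x y z → +-assoc _ _ _ , +-assoc _ _ _
                }
              ; identity = (λ _ → +-identityˡ _ , +-identityˡ _) , (λ _ → +-identityʳ _ , +-identityʳ _)
              }
            ; inverse = (λ _ → -‿inverseˡ _ , -‿inverseˡ _) , (λ _ → -‿inverseʳ _ , -‿inverseʳ _)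
            ; ⁻¹-cong = λ (p , q) → -‿cong p , -‿cong q
            }
          ; comm = λ _ _ → +-comm _ _ , +-comm _ _
          }
        ; *-cong = λ (p , q) (p′ , q′) → +-cong (*-cong p p′) (-‿cong (*-cong q q′)) , +-cong (*-cong p q′)
          (*-cong q p′)
        ; *-assoc = λ (a +i b) (c +i d) (e +i f) →
            solve 6 (λ a b c d e f → (a :* c :- b :* d) :* e :- (a :* d :+ b :* c) :* f :=
              a :* (c :* e :- d :* f) :- b :* (c :* f :+ d :* e)) refl a b c d e f ,
            solve 6 (λ a b c d e f → (a :* c :- b :* d) :* f :+ (a :* d :+ b :* c) :* e :=
              a :* (c :* f :+ d :* e) :+ b :* (c :* e :- d :* f)) refl a b c d e f
        ; *-identity = (λ z → *-identityˡℂ z) , (λ (a +i b) →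
            solve 2 (λ a b → a :* con (+ 1) :- b :* con (+ 0) := a) refl a b ,
            solve 2 (λ a b → a :* con (+ 0) :+ b :* con (+ 1) := b) refl a b)
        ; distrib =
            (λ (a +i b) (c +i d) (e +i f) →
              solve 6 (λ a b c d e f → a :* (c :+ e) :- b :* (d :+ f) := a :* c :- b :* d :+
                (a :* e :- b :* f)) refl a b c d e f ,
              solve 6 (λ a b c d e f → a :* (d :+ f) :+ b :* (c :+ e) := a :* d :+ b :* c :+
                (a :* f :+ b :* e)) refl a b c d e f) ,
            (λ (a +i b) (c +i d) (e +i f) →
              solve 6 (λ a b c d e f → (c :+ e) :* a :- (d :+ f) :* b := c :* a :- d :* b :+
                (e :* a :- f :* b)) refl a b c d e f ,
              solve 6 (λ a b c d e f → (c :+ e) :* b :+ (d :+ f) :* a := c :* b :+ d :* a :+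
                (e :* b :+ f :* a)) refl a b c d e f)
        }
      ; *-comm = λ (a +i b) (c +i d) →
          solve 4 (λ a b c d → a :* c :- b :* d := c :* a :- d :* b) refl a b c d ,
          solve 4 (λ a b c d → a :* d :+ b :* c := c :* b :+ d :* a) refl a b c d
      }
    }
    where
    *-identityˡℂ : ∀ z → 1ℂ *ℂ z ≈ℂ z
    *-identityˡℂ (a +i b) = solve 2 (λ a b → con (+ 1) :* a :- con (+ 0) :* b := a) refl a b ,
                            solve 2 (λ a b → con (+ 1) :* b :+ con (+ 0) :* a := b) refl a b

  module ℂᴿ = CommutativeRing ℂ-commutativeRing
  open IntegerCoefficientSolver ℂ-commutativeRing public using () renaming
    (solve to solveℂ; _:=_ to _⊜_; _:+_ to _⊕_; _:*_ to _⊗_; _:-_ to _⊝_; con to conℂ)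
  open SemiringMult ℂᴿ.semiring using () renaming (_×_ to _·ℂ_)

  open Convolution commutativeRing public using
    (Σ; Σ-cong; Σ-snoc; conv; IsExpSequence; conv-expSequence; Σ-conv-suc)
  open Convolution ℂ-commutativeRing public using () renaming
    (Σ to Σℂ; conv to convℂ; Σ-cong to Σℂ-cong; Σ-snoc to Σℂ-snoc; IsExpSequence to IsExpSequenceℂ; conv-expSequence to conv-expSequenceℂ; Σ-conv-suc to Σ-conv-sucℂ)

  -- z ≪ r says that the ℓ¹-norm of z is at most r.
  data _≪_ (z : ℂ) (r : Carrier) : Set where
    majorant : ∀ {A B} → Bounded (re z) A → Bounded (im z) B → A + B ≤ r → z ≪ r

  infix 4 _≪_

  ≪-resp : ∀ {z w r} → z ≈ℂ w → z ≪ r → w ≪ r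
  ≪-resp (p , q) (majorant a b A+B≤r) = majorant (bounded-resp p a) (bounded-resp q b) A+B≤r

  ≪-weaken : ∀ {z r s} → r ≤ s → z ≪ r → z ≪ s
  ≪-weaken r≤s (majorant a b A+B≤r) = majorant a b (≤-trans A+B≤r r≤s)

  ≪-nonneg : ∀ {z r} → z ≪ r → 0# ≤ r
  ≪-nonneg (majorant a b A+B≤r) = ≤-trans (0≤+ (bounded-nonneg a) (bounded-nonneg b)) A+B≤r

  ≪⇒re : ∀ {z r} → z ≪ r → Bounded (re z) r
  ≪⇒re (majorant a b A+B≤r) = bounded-weaken
    (≤-trans (≤-respˡ (+-identityʳ _) (+-mono-≤ ≤-refl (bounded-nonneg b))) A+B≤r) a

  ≪⇒im : ∀ {z r} → z ≪ r → Bounded (im z) r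
  ≪⇒im (majorant a b A+B≤r) = bounded-weaken
    (≤-trans (≤-respˡ (+-identityˡ _) (+-mono-≤ (bounded-nonneg a) ≤-refl)) A+B≤r) b

  ≪-ofReal : ∀ {x r} → Bounded x r → ofReal x ≪ r
  ≪-ofReal b = majorant b bounded-0 (≤-reflexive (+-identityʳ _))

  ≪-imaginary : ∀ {x r} → Bounded x r → (0# +i x) ≪ r
  ≪-imaginary b = majorant bounded-0 b (≤-reflexive (+-identityˡ _))

  ≪-0 : 0ℂ ≪ 0#
  ≪-0 = ≪-ofReal bounded-0

  ≪-1 : 1ℂ ≪ 1#
  ≪-1 = ≪-ofReal (nonneg⇒bounded 0≤1 ≤-refl)

  ≪-+ : ∀ {z w r s} → z ≪ r → w ≪ s → z +ℂ w ≪ r + s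
  ≪-+ (majorant {A} {B} a b AB) (majorant {C} {D} c d CD) = majorant (bounded-+ a c) (bounded-+ b d)
    (≤-respˡ (solve 4 (λ A B C D → A :+ B :+ (C :+ D) := A :+ C :+ (B :+ D)) refl A B C D) (+-mono-≤ AB CD))

  ≪-neg : ∀ {z r} → z ≪ r → -ℂ z ≪ r
  ≪-neg (majorant a b AB) = majorant (bounded-neg a) (bounded-neg b) AB

  ≪-* : ∀ {z w r s} → z ≪ r → w ≪ s → z *ℂ w ≪ r * s
  ≪-* z≪r@(majorant {A} {B} a b AB) w≪s@(majorant {C} {D} c d CD) = majorant
    (bounded-+ (bounded-* a c) (bounded-neg (bounded-* b d)))
    (bounded-+ (bounded-* a d) (bounded-* b c))
    (≤-respˡ (solve 4 (λ A B C D → (A :+ B) :* (C :+ D) := A :* C :+ B :* D :+ (A :* D :+ B :* C)) refl A B C D)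
      (*-mono-≤ (0≤+ (bounded-nonneg a) (bounded-nonneg b)) (≪-nonneg w≪s) AB CD))

  ≪-^ : ∀ {z r} k → z ≪ r → z ^ℂ k ≪ r ^ k
  ≪-^ zero    z≪r = ≪-1
  ≪-^ (suc k) z≪r = ≪-* z≪r (≪-^ k z≪r)

  Σ-nonneg : ∀ {f} m → (∀ k → 0# ≤ f k) → 0# ≤ Σ f m
  Σ-nonneg zero    0≤f = ≤-refl
  Σ-nonneg (suc m) 0≤f = 0≤+ (0≤f 0) (Σ-nonneg m (0≤f ∘ suc))

  Σ-mono-≤ : ∀ {f g} m → (∀ k → f k ≤ g k) → Σ f m ≤ Σ g m
  Σ-mono-≤ zero    f≤g = ≤-refl
  Σ-mono-≤ (suc m) f≤g = +-mono-≤ (f≤g 0) (Σ-mono-≤ m (f≤g ∘ suc))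

  Σ-segment : ∀ f {m n} → m ℕ.≤ n → (∀ k → 0# ≤ f k) → Σ f m ≤ Σ f n
  Σ-segment f {n = n} ℕ.z≤n 0≤f = Σ-nonneg n 0≤f
  Σ-segment f (ℕ.s≤s m≤n) 0≤f = +-mono-≤ ≤-refl (Σ-segment (f ∘ suc) m≤n (0≤f ∘ suc))

  Σ-≪ : ∀ {f α} m → (∀ k → f k ≪ α k) → Σℂ f m ≪ Σ α m
  Σ-≪ zero    f≪α = ≪-0
  Σ-≪ (suc m) f≪α = ≪-+ (f≪α 0) (Σ-≪ m (f≪α ∘ suc))

  Σ-segment-≪ : ∀ {f α m n} → m ℕ.≤ n → (∀ k → f k ≪ α k) → Σℂ f n +ℂ -ℂ Σℂ f m ≪ Σ α n - Σ α m
  Σ-segment-≪ {f} {α} {n = n} ℕ.z≤n f≪α = ≪-weaken (≤-reflexive (solve 1 (λ x → x := x :- con (+ 0)) refl (Σ α n)))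
    (≪-resp (ℂᴿ.sym (ℂᴿ.trans (ℂᴿ.+-congˡ { Σℂ f n }
      (solve 0 (:- con (+ 0) := con (+ 0)) refl , solve 0 (:- con (+ 0) := con (+ 0)) refl))
      (ℂᴿ.+-identityʳ (Σℂ f n)))) (Σ-≪ n f≪α))
  Σ-segment-≪ {f} {α} {suc m} {suc n} (ℕ.s≤s m≤n) f≪α = ≪-weaken
    (≤-reflexive (cancel (α 0) (Σ (α ∘ suc) n) (Σ (α ∘ suc) m)))
    (≪-resp (cancel (re (f 0)) _ _ , cancel (im (f 0)) _ _) (Σ-segment-≪ m≤n (f≪α ∘ suc)))
    where
    cancel : ∀ x y z → y - z ≈ (x + y) - (x + z)
    cancel = solve 3 (λ x y z → y :- z := x :+ y :- (x :+ z)) refl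

  -- The product of two partial sums differs from the partial sum of the Cauchy
  -- product by terms outside a triangle, and passing to majorants termwise
  -- keeps this difference in the same form.
  cauchy-≪ : ∀ {f g α β m n} → m ℕ.≤ n → (∀ k → f k ≪ α k) → (∀ k → g k ≪ β k) →
             Σℂ f m *ℂ Σℂ g n +ℂ -ℂ Σℂ (convℂ f g) m ≪ Σ α m * Σ β n - Σ (conv α β) m
  cauchy-≪ {f} {g} {α} {β} {zero} {n} _ f≪α g≪β = ≪-weaken
    (≤-reflexive (solve 1 (λ x → con (+ 0) := con (+ 0) :* x :- con (+ 0)) refl (Σ β n)))
    (≪-resp (solveℂ 1 (λ x → conℂ (+ 0) ⊜ conℂ (+ 0) ⊗ x ⊝ conℂ (+ 0)) ℂᴿ.refl (Σℂ g n)) ≪-0)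
  cauchy-≪ {f} {g} {α} {β} {suc m} {n} m<n f≪α g≪β = ≪-weaken
    (≤-reflexive (trans
      (solve 5 (λ a b b′ s c → a :* (b :- b′) :+ (s :* b :- c) := (a :+ s) :* b :- (a :* b′ :+ c)) refl
        (α 0) (Σ β n) (Σ β (suc m)) (Σ (α ∘ suc) m) (Σ (conv (α ∘ suc) β) m))
      (+-congˡ (-‿cong (sym (Σ-conv-suc α β m))))))
    (≪-resp (ℂᴿ.trans
      (solveℂ 5 (λ a b b′ s c → a ⊗ (b ⊝ b′) ⊕ (s ⊗ b ⊝ c) ⊜ (a ⊕ s) ⊗ b ⊝ (a ⊗ b′ ⊕ c)) ℂᴿ.refl
        (f 0) (Σℂ g n) (Σℂ g (suc m)) (Σℂ (f ∘ suc) m) (Σℂ (convℂ (f ∘ suc) g) m))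
      (ℂᴿ.+-congˡ {Σℂ f (suc m) *ℂ Σℂ g n} (ℂᴿ.-‿cong (ℂᴿ.sym (Σ-conv-sucℂ f g m)))))
      (≪-+ (≪-* (f≪α 0) (Σ-segment-≪ m<n g≪β)) (cauchy-≪ (ℕ.<⇒≤ m<n) (f≪α ∘ suc) g≪β)))

  -- The rectangle of indices `i < m`, `j < n` lies inside the triangle `i + j < m + n`, and all the
  -- terms are non-negative.
  Σ-conv-grow : ∀ {α β} m n → (∀ k → 0# ≤ α k) → (∀ k → 0# ≤ β k) → Σ α m * Σ β n ≤ Σ (conv α β) (m ℕ.+ n)
  Σ-conv-grow {α} {β} zero n 0≤α 0≤β = ≤-respˡ (sym (zeroˡ (Σ β n))) (Σ-nonneg n (conv-nonneg 0≤α))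
    where
    conv-nonneg : ∀ {α} → (∀ k → 0# ≤ α k) → ∀ k → 0# ≤ conv α β k
    conv-nonneg 0≤α zero    = 0≤* (0≤α 0) (0≤β 0)
    conv-nonneg 0≤α (suc k) = 0≤+ (0≤* (0≤α 0) (0≤β (suc k))) (conv-nonneg (0≤α ∘ suc) k)
  Σ-conv-grow {α} {β} (suc m) n 0≤α 0≤β = ≤-respʳ (sym (Σ-conv-suc α β (m ℕ.+ n)))
    (≤-respˡ (sym (distribʳ (Σ β n) (α 0) (Σ (α ∘ suc) m)))
    (+-mono-≤ (*-monoˡ-≤ (0≤α 0) (Σ-segment β (ℕ.≤-trans (ℕ.m≤n+m n m) (ℕ.n≤1+n (m ℕ.+ n))) 0≤β))
              (Σ-conv-grow m n (0≤α ∘ suc) 0≤β)))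

  -- Terms of the exponential series.

  factorial-pos : ∀ k → 0# < fromNat (k !)
  factorial-pos k with k ! | ℕ.1≤n! k
  ... | suc m | _ = fromNat-pos m

  factorial-inverse : ∀ k → fromNat (suc k) * fromNat (suc k !) ⁻¹ ≈ fromNat (k !) ⁻¹
  factorial-inverse k = *-cancelˡ-≈ (factorial-pos k) (trans
    (solve 3 (λ x y z → x :* (y :* z) := y :* x :* z) refl (fromNat (k !)) (fromNat (suc k)) (fromNat (suc k !) ⁻¹))
    (trans (*-congʳ (sym (×1-homo-* (suc k) (k !))))
      (trans (⁻¹-inverseʳ _ (0<⇒≉0 (factorial-pos (suc k)))) (sym (⁻¹-inverseʳ _ (0<⇒≉0 (factorial-pos k)))))))

  0!⁻¹≈1 : fromNat (0 !) ⁻¹ ≈ 1#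
  0!⁻¹≈1 = *-cancelˡ-≈ (factorial-pos 0) (trans (⁻¹-inverseʳ _ (0<⇒≉0 (factorial-pos 0)))
    (solve 0 (con (+ 1) := (con (+ 1) :+ con (+ 0)) :* con (+ 1)) refl))

  term : Carrier → ℕ → Carrier
  term x k = fromNat (k !) ⁻¹ * x ^ k

  termℂ : ℂ → ℕ → ℂ
  termℂ z k = ofReal (fromNat (k !) ⁻¹) *ℂ (z ^ℂ k)

  term-isExpSequence : ∀ x → IsExpSequence x (term x)
  term-isExpSequence x = trans (*-identityʳ _) 0!⁻¹≈1 , λ k → trans
    (solve 4 (λ m i x p → m :* (i :* (x :* p)) := m :* i :* (x :* p)) refl (fromNat (suc k))
      (fromNat (suc k !) ⁻¹) x (x ^ k))
    (trans (*-congʳ (factorial-inverse k)) (solve 3 (λ i x p → i :* (x :* p) := x :* (i :* p)) refl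
      (fromNat (k !) ⁻¹) x (x ^ k)))

  ofReal-cong : ∀ {x y} → x ≈ y → ofReal x ≈ℂ ofReal y
  ofReal-cong x≈y = x≈y , refl

  ofReal-* : ∀ x y → ofReal x *ℂ ofReal y ≈ℂ ofReal (x * y)
  ofReal-* x y = solve 2 (λ x y → x :* y :- con (+ 0) :* con (+ 0) := x :* y) refl x y ,
                 solve 2 (λ x y → x :* con (+ 0) :+ con (+ 0) :* y := con (+ 0)) refl x y

  ofReal-fromNat : ∀ k → k ·ℂ 1ℂ ≈ℂ ofReal (fromNat k)
  ofReal-fromNat zero    = refl , refl
  ofReal-fromNat (suc k) with ofReal-fromNat k
  ... | p , q = +-congˡ p , trans (+-identityˡ _) q

  termℂ-isExpSequence : ∀ z → IsExpSequenceℂ z (termℂ z)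
  termℂ-isExpSequence z = ℂᴿ.trans (ℂᴿ.*-identityʳ (ofReal (fromNat (0 !) ⁻¹))) (ofReal-cong 0!⁻¹≈1) , λ k →
    ℂᴿ.trans
    (solveℂ 4 (λ m i x p → m ⊗ (i ⊗ (x ⊗ p)) ⊜ m ⊗ i ⊗ (x ⊗ p)) ℂᴿ.refl (suc k ·ℂ 1ℂ)
      (ofReal (fromNat (suc k !) ⁻¹)) z (z ^ℂ k))
    (ℂᴿ.trans (ℂᴿ.*-congʳ {z *ℂ (z ^ℂ k)}
      (ℂᴿ.trans (ℂᴿ.*-congʳ {ofReal (fromNat (suc k !) ⁻¹)} (ofReal-fromNat (suc k)))
      (ℂᴿ.trans (ofReal-* (fromNat (suc k)) (fromNat (suc k !) ⁻¹)) (ofReal-cong (factorial-inverse k)))))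
      (solveℂ 3 (λ i x p → i ⊗ (x ⊗ p) ⊜ x ⊗ (i ⊗ p)) ℂᴿ.refl (ofReal (fromNat (k !) ⁻¹)) z (z ^ℂ k)))

  term-nonneg : ∀ {x} → 0# ≤ x → ∀ k → 0# ≤ term x k
  term-nonneg 0≤x k = 0≤* (<⇒≤ (0<⁻¹ (factorial-pos k))) (^-nonneg k 0≤x)

  term-mono-≤ : ∀ {x y} → 0# ≤ x → x ≤ y → ∀ k → term x k ≤ term y k
  term-mono-≤ 0≤x x≤y k = *-monoˡ-≤ (<⇒≤ (0<⁻¹ (factorial-pos k))) (^-mono-≤ k 0≤x x≤y)

  termℂ-≪ : ∀ {z x} → z ≪ x → ∀ k → termℂ z k ≪ term x k
  termℂ-≪ z≪x k = ≪-* (≪-ofReal (nonneg⇒bounded (<⇒≤ (0<⁻¹ (factorial-pos k))) ≤-refl)) (≪-^ k z≪x)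

  expSequence-unique : ∀ {x f g} → IsExpSequence x f → IsExpSequence x g → ∀ k → f k ≈ g k
  expSequence-unique (f0 , f⁺) (g0 , g⁺) zero    = trans f0 (sym g0)
  expSequence-unique F@(f0 , f⁺) G@(g0 , g⁺) (suc k) = *-cancelˡ-≈ (fromNat-pos k)
    (trans (f⁺ k) (trans (*-congˡ (expSequence-unique F G k)) (sym (g⁺ k))))

  expSequence-uniqueℂ : ∀ {x f g} → IsExpSequenceℂ x f → IsExpSequenceℂ x g → ∀ k → f k ≈ℂ g k
  expSequence-uniqueℂ (f0 , f⁺) (g0 , g⁺) zero    = ℂᴿ.trans f0 (ℂᴿ.sym g0)
  expSequence-uniqueℂ {x} {f} {g} F@(f0 , f⁺) G@(g0 , g⁺) (suc k) =
    *-cancelˡ-≈ (fromNat-pos k) (trans (sym (scale-re (f (suc k)))) (trans (proj₁ fg) (scale-re (g (suc k))))) ,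
    *-cancelˡ-≈ (fromNat-pos k) (trans (sym (scale-im (f (suc k)))) (trans (proj₂ fg) (scale-im (g (suc k)))))
    where
    m = fromNat (suc k)
    fg : ofReal m *ℂ f (suc k) ≈ℂ ofReal m *ℂ g (suc k)
    fg = ℂᴿ.trans (ℂᴿ.*-congʳ {f (suc k)} (ℂᴿ.sym (ofReal-fromNat (suc k)))) (ℂᴿ.trans (f⁺ k)
      (ℂᴿ.trans (ℂᴿ.*-congˡ {x} (expSequence-uniqueℂ F G k))
        (ℂᴿ.trans (ℂᴿ.sym (g⁺ k)) (ℂᴿ.*-congʳ {g (suc k)} (ofReal-fromNat (suc k))))))
    scale-re : ∀ z → re (ofReal m *ℂ z) ≈ m * re z
    scale-re (a +i b) = solve 3 (λ m a b → m :* a :- con (+ 0) :* b := m :* a) refl m a b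
    scale-im : ∀ z → im (ofReal m *ℂ z) ≈ m * im z
    scale-im (a +i b) = solve 3 (λ m a b → m :* b :+ con (+ 0) :* a := m :* b) refl m a b

  normSq-* : ∀ z w → normSq (z *ℂ w) ≈ normSq z * normSq w
  normSq-* (a +i b) (c +i d) = solve 4 (λ a b c d → (a :* c :- b :* d) :* (a :* c :- b :* d) :+
    (a :* d :+ b :* c) :* (a :* d :+ b :* c) :=
    (a :* a :+ b :* b) :* (c :* c :+ d :* d)) refl a b c d

  normSq-imaginary^ : ∀ y k → normSq ((0# +i y) ^ℂ k) ≈ y ^ k * y ^ k
  normSq-imaginary^ y zero    = solve 0
    (con (+ 1) :* con (+ 1) :+ con (+ 0) :* con (+ 0) := con (+ 1) :* con (+ 1)) refl
  normSq-imaginary^ y (suc k) = trans (normSq-* (0# +i y) ((0# +i y) ^ℂ k)) (trans (*-congˡ (normSq-imaginary^ y k))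
    (solve 2 (λ y p → (con (+ 0) :* con (+ 0) :+ y :* y) :* (p :* p) := y :* p :* (y :* p)) refl y (y ^ k)))

  normSq-termℂ : ∀ y k → normSq (termℂ (0# +i y) k) ≈ term y k * term y k
  normSq-termℂ y k = trans (normSq-* (ofReal i) ((0# +i y) ^ℂ k)) (trans (*-congˡ (normSq-imaginary^ y k))
    (solve 2 (λ i p → (i :* i :+ con (+ 0) :* con (+ 0)) :* (p :* p) := i :* p :* (i :* p)) refl i (y ^ k)))
    where i = fromNat (k !) ⁻¹

  fromNat-^ : ∀ q k → fromNat (q ℕ.^ k) ≈ fromNat q ^ k
  fromNat-^ q zero    = +-identityʳ 1#
  fromNat-^ q (suc k) = trans (×1-homo-* q (q ℕ.^ k)) (*-congˡ (fromNat-^ q k))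

  1≤^ : ∀ {x} k → 1# ≤ x → 1# ≤ x ^ k
  1≤^ zero    1≤x = ≤-refl
  1≤^ (suc k) 1≤x = ≤-respˡ (*-identityˡ 1#) (*-mono-≤ 0≤1 (≤-trans 0≤1 (1≤^ k 1≤x)) 1≤x (1≤^ k 1≤x))

  *-^ : ∀ x y k → (x * y) ^ k ≈ x ^ k * y ^ k
  *-^ x y zero    = sym (*-identityˡ 1#)
  *-^ x y (suc k) = trans (*-congˡ (*-^ x y k))
    (solve 4 (λ x y p q → x :* y :* (p :* q) := x :* p :* (y :* q)) refl x y (x ^ k) (y ^ k))

  square-cancel-≤ : ∀ {x y} → 0# < y → x * x ≤ y * y → x ≤ y
  square-cancel-≤ {x} {y} 0<y x²≤y² with ≤∨> x y
  ... | inj₁ x≤y = x≤y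
  ... | inj₂ y<x = ⊥-elim (≤⇒≯ x²≤y²
    (≤-<-trans (*-monoˡ-≤ (<⇒≤ 0<y) (<⇒≤ y<x)) (<-respˡ (*-comm x y) (*-monoˡ-< (<-trans 0<y y<x) y<x))))

  -- No tail estimate is available before the Archimedean property, but a term is the difference of
  -- two consecutive partial sums. Once both are within `ε` of the limit, its real and imaginary
  -- parts are at most `2 ε`, so the square of `term y m` is at most `8 ε²`, which is below
  -- `(4 ε)²`.
  term-small : ∀ {y e ε} → 0# < ε → IsCis y e → ∃[ m ] term y m ≤ 2# * 2# * ε
  term-small {y} {e} {ε} 0<ε S→e = m , square-cancel-≤ 0<4ε
      (≤-respˡ (normSq-termℂ y m) (≤-trans
        (+-mono-≤ (proj₂ (bounded-* re≤ re≤)) (proj₂ (bounded-* im≤ im≤)))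
        (≤-by (0≤* (0≤x*x ε) (<⇒≤ (*-pos (*-pos 0<2 0<2) 0<2)))
          (solve 1 (λ ε → (con (+ 2) :* con (+ 2) :* ε) :* (con (+ 2) :* con (+ 2) :* ε) :-
            ((ε :+ ε) :* (ε :+ ε) :+ (ε :+ ε) :* (ε :+ ε)) := ε :* ε :*
            (con (+ 2) :* con (+ 2) :* con (+ 2))) refl ε))))
    where
    m = proj₁ (S→e ε 0<ε)
    z = 0# +i y
    close = proj₂ (S→e ε 0<ε)
    0<4ε = *-pos (*-pos 0<2 0<2) 0<ε
    step : (expPartialSum z (suc m) +ℂ -ℂ e) +ℂ -ℂ (expPartialSum z m +ℂ -ℂ e) ≈ℂ termℂ z m
    step = ℂᴿ.trans (ℂᴿ.+-congʳ (ℂᴿ.+-congʳ (Σℂ-snoc (termℂ z) m)))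
      (solveℂ 3 (λ s t e → (s ⊕ t ⊝ e) ⊝ (s ⊝ e) ⊜ t) ℂᴿ.refl (expPartialSum z m) (termℂ z m) e)
    re≤ : Bounded (re (termℂ z m)) (ε + ε)
    re≤ = bounded-resp (proj₁ step) (bounded-+ (sq<⇒bounded 0<ε (close (suc m) (ℕ.n≤1+n m)))
      (bounded-neg (sq<⇒bounded 0<ε (close m ℕ.≤-refl))))
    im≤ : Bounded (im (termℂ z m)) (ε + ε)
    im≤ = bounded-resp (proj₂ step)
      (bounded-+ (sq<⇒bounded 0<ε (<-respˡ (+-comm _ _) (close (suc m) (ℕ.n≤1+n m))))
      (bounded-neg (sq<⇒bounded 0<ε (<-respˡ (+-comm _ _) (close m ℕ.≤-refl)))))

  -- Completeness alone only refutes the absence of a natural number above x;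
  -- the modulus of convergence of the series for exp (i y) produces one,
  -- because y ^ m / m ! ≤ 4 ε = 1 / x and 1 ≤ q y give x ≤ q ^ m * m !.
  archimedean-from-cis : ∀ {y e} q → 0# < y → 1# ≤ fromNat q * y → IsCis y e → ∀ x → ∃[ n ] x < fromNat n
  archimedean-from-cis {y} {e} q 0<y 1≤qy S→e x with ≤∨> x 0#
  ... | inj₁ x≤0 = 1 , ≤-<-trans x≤0 (fromNat-pos 0)
  ... | inj₂ 0<x = suc (q ℕ.^ m ℕ.* m !) , ≤-<-trans
      (≤-respʳ (trans (*-cong (sym (fromNat-^ q m)) refl) (sym (×1-homo-* (q ℕ.^ m) (m !)))) x≤)
      (<-by 0<1 (solve 1 (λ s → con (+ 1) :+ s :- s := con (+ 1)) refl (fromNat (q ℕ.^ m ℕ.* m !))))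
    where
    4x>0 = *-pos (*-pos 0<2 0<2) 0<x
    ε = 1# / (2# * 2# * x)
    small = term-small {y} {e} (0</ 0<1 4x>0) S→e
    m = proj₁ small
    x≤ : x ≤ fromNat q ^ m * fromNat (m !)
    x≤ = ≤-trans (≤-trans
      (≤-respˡ (*-identityʳ x) (*-monoˡ-≤ (<⇒≤ 0<x) (≤-respʳ (*-^ (fromNat q) y m) (1≤^ m 1≤qy))))
      (≤-reflexive (trans (sym (*-identityˡ _)) (trans (*-congʳ (sym (⁻¹-inverseʳ _ (0<⇒≉0 (factorial-pos m)))))
        (solve 5 (λ f i x Q p → f :* i :* (x :* (Q :* p)) := Q :* f :* (x :* (i :* p))) refl (fromNat (m !))
          (fromNat (m !) ⁻¹) x (fromNat q ^ m) (y ^ m)))))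
      )
      (≤-respʳ (trans (*-congˡ (trans (solve 3 (λ x c e → x :* (c :* e) := c :* x :* e) refl x (2# * 2#) ε)
        (*/-cancel 4x>0))) (*-identityʳ _))
        (*-monoˡ-≤ (0≤* (^-nonneg m (fromNat-nonneg q)) (fromNat-nonneg (m !)))
          (*-monoˡ-≤ (<⇒≤ 0<x) (proj₂ small))))

-- The functions cis and sine on a bounded interval.

module Cis (ℝ : CompleteOrderedField) where
  open Real ℝ
  open Complex ℝ
  open OrderedField ℝ
  open ExponentialSeries ℝ
  open MonoidMult +-monoid using (×-homo-+)

  module _ (archimedean : ∀ x → ∃[ n ] x < fromNat n) (X : Carrier) (0<X : 0# < X)
           (N₀ : ℕ) (2≤N₀ : 2 ℕ.≤ N₀) (N₀-large : X + X + (X + X) ≤ fromNat N₀) where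

    0≤X : 0# ≤ X
    0≤X = <⇒≤ 0<X

    -- The terms of the series for `exp (2 X)`. Twice `X` is needed because the majorant of a
    -- product of two series, each majorised by `exp X`, is `exp X * exp X`.
    T : ℕ → Carrier
    T = term (X + X)

    0<T : ∀ k → 0# < T k
    0<T k = *-pos (0<⁻¹ (factorial-pos k)) (^-pos k (0<+ 0<X 0≤X))

    0≤T : ∀ k → 0# ≤ T k
    0≤T k = <⇒≤ (0<T k)

    -- The quotient of consecutive terms is `2 X / (k + 1)`, and `4 X ≤ N₀ ≤ k + 1`.
    T-halves : ∀ k → N₀ ℕ.≤ k → 2# * T (suc k) ≤ T k
    T-halves k N₀≤k = *-cancelˡ-≤ (fromNat-pos k) (≤-respˡ
      (trans (solve 2 (λ x t → (x :+ x :+ (x :+ x)) :* t := con (+ 2) :* ((x :+ x) :* t)) refl X (T k))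
        (trans (*-congˡ (sym (proj₂ (term-isExpSequence (X + X)) k)))
          (solve 2 (λ m t → con (+ 2) :* (m :* t) := m :* (con (+ 2) :* t)) refl (fromNat (suc k)) (T (suc k)))))
      (*-monoʳ-≤ (0≤T k) (≤-trans N₀-large (fromNat-mono-≤ (ℕ.m≤n⇒m≤1+n N₀≤k)))))

    -- The quantity `Σ T m + 2 T m` never increases beyond `N₀`: a step adds `T m` to the sum and
    -- replaces `2 T m` by `2 T (m + 1) ≤ T m`. This is the geometric tail bound without an infinite
    -- sum.
    tail-bound : ∀ j m → N₀ ℕ.≤ m → Σ T (j ℕ.+ m) + 2# * T (j ℕ.+ m) ≤ Σ T m + 2# * T m
    tail-bound zero    m N₀≤m = ≤-refl
    tail-bound (suc j) m N₀≤m = ≤-trans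
      (≤-by (x≤y⇒0≤y-x (T-halves (j ℕ.+ m) (ℕ.≤-trans N₀≤m (ℕ.m≤n+m m j))))
        (trans (+-congˡ (-‿cong (+-congʳ (Σ-snoc T (j ℕ.+ m)))))
          (solve 3 (λ s t t′ → s :+ con (+ 2) :* t :- (s :+ t :+ con (+ 2) :* t′) := t :- con (+ 2) :* t′) refl
            (Σ T (j ℕ.+ m)) (T (j ℕ.+ m)) (T (suc j ℕ.+ m)))))
      (tail-bound j m N₀≤m)

    tail-≤ : ∀ {m n} → N₀ ℕ.≤ m → m ℕ.≤ n → Σ T n - Σ T m ≤ 2# * T m
    tail-≤ {m} {n} N₀≤m m≤n = ≤-by
      (0≤+ (x≤y⇒0≤y-x (≡.subst (λ n → Σ T n + 2# * T n ≤ Σ T m + 2# * T m) (ℕ.m∸n+n≡m m≤n)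
        (tail-bound (n ℕ.∸ m) m N₀≤m)))
           (0≤* (<⇒≤ 0<2) (0≤T n)))
      (solve 4 (λ s t s′ t′ → con (+ 2) :* t :- (s′ :- s) := s :+ con (+ 2) :* t :-
        (s′ :+ con (+ 2) :* t′) :+ con (+ 2) :* t′) refl
        (Σ T m) (T m) (Σ T n) (T n))

    -- A positive bound for every partial sum of `T`. It also serves as the Lipschitz constant of
    -- the sine and as the coefficient of the quadratic error in `sin-lower`.
    L : Carrier
    L = 1# + (Σ T N₀ + 2# * T N₀)

    Σ≤L : ∀ m → Σ T m ≤ L
    Σ≤L m with ℕ.≤-total N₀ m
    ... | inj₁ N₀≤m = ≤-by (0≤+ 0≤1 (x≤y⇒0≤y-x (tail-≤ ℕ.≤-refl N₀≤m)))
      (solve 3 (λ s t s′ → con (+ 1) :+ (s :+ t) :- s′ := con (+ 1) :+ (t :- (s′ :- s))) refl (Σ T N₀)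
        (2# * T N₀) (Σ T m))
    ... | inj₂ m≤N₀ = ≤-trans (Σ-segment T m≤N₀ 0≤T) (≤-by (0≤+ 0≤1 (0≤* (<⇒≤ 0<2) (0≤T N₀)))
      (solve 2 (λ s t → con (+ 1) :+ (s :+ t) :- s := con (+ 1) :+ t) refl (Σ T N₀) (2# * T N₀)))

    0<L : 0# < L
    0<L = 0<+ 0<1 (0≤+ (Σ-nonneg N₀ 0≤T) (0≤* (<⇒≤ 0<2) (0≤T N₀)))

    -- Halving outweighs the growth of the factor, as `j + 2 ≤ 2 (j + 1)`. Decay like `1 / (j + 1)`
    -- is slower than the true geometric rate but is the form in which `archimedean` applies
    -- directly.
    T-decay : ∀ j → fromNat (suc j) * T (j ℕ.+ N₀) ≤ T N₀
    T-decay zero    = ≤-reflexive (solve 1 (λ t → (con (+ 1) :+ con (+ 0)) :* t := t) refl (T N₀))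
    T-decay (suc j) = ≤-trans
      (≤-by (0≤+ (0≤* (fromNat-nonneg (suc j)) (x≤y⇒0≤y-x (T-halves (j ℕ.+ N₀) (ℕ.m≤n+m N₀ j))))
        (0≤* (fromNat-nonneg j) (0≤T (suc j ℕ.+ N₀))))
        (solve 3 (λ m t t′ → (con (+ 1) :+ m) :* t :- (con (+ 1) :+ (con (+ 1) :+ m)) :* t′ :=
          (con (+ 1) :+ m) :* (t :- con (+ 2) :* t′) :+ m :* t′) refl
          (fromNat j) (T (j ℕ.+ N₀)) (T (suc j ℕ.+ N₀))))
      (T-decay j)

    T→0 : ∀ {C ε} → 0# ≤ C → 0# < ε → ∃[ M ] (N₀ ℕ.≤ M × (∀ m → M ℕ.≤ m → C * T m < ε))
    T→0 {C} {ε} 0≤C 0<ε = n ℕ.+ N₀ , ℕ.m≤n+m N₀ n , λ m M≤m → ≡.subst (λ m → C * T m < ε)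
      (ℕ.m∸n+n≡m (ℕ.≤-trans (ℕ.m≤n+m N₀ n) M≤m))
        (small (m ℕ.∸ N₀) (ℕ.≤-trans (ℕ.≤-reflexive (≡.sym (ℕ.m+n∸n≡m n N₀))) (ℕ.∸-monoˡ-≤ N₀ M≤m)))
      where
      large = archimedean (C * T N₀ / ε)
      n = proj₁ large
      small : ∀ j → n ℕ.≤ j → C * T (j ℕ.+ N₀) < ε
      small j n≤j = *-cancelˡ-< (fromNat-pos j) (≤-<-trans
        (≤-respˡ (solve 3 (λ m c t → c :* (m :* t) := m :* (c :* t)) refl (fromNat (suc j)) C (T (j ℕ.+ N₀)))
          (*-monoˡ-≤ 0≤C (T-decay j)))
        (<-≤-trans (<-respˡ (*/-cancel 0<ε) (*-monoˡ-< 0<ε (proj₂ large)))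
          (≤-respˡ (*-comm _ _) (*-monoʳ-≤ (<⇒≤ 0<ε) (fromNat-mono-≤ (ℕ.m≤n⇒m≤1+n n≤j))))))

    vanishing : ∀ {d C} → (∀ m → N₀ ℕ.≤ m → d ≤ C * T m) → 0# ≤ C → d ≤ 0#
    vanishing {d} d≤ 0≤C with ≤∨> d 0#
    ... | inj₁ d≤0 = d≤0
    ... | inj₂ 0<d = let M , N₀≤M , small = T→0 0≤C 0<d in ⊥-elim (≤⇒≯ (d≤ M N₀≤M) (small M ℕ.≤-refl))

    -- All limits in question converge at the rate T; fixing this rate avoids
    -- moduli of convergence.
    Limit : (ℕ → ℂ) → ℂ → Set
    Limit u e = ∃[ C ] (∀ m → N₀ ℕ.≤ m → u m +ℂ -ℂ e ≪ C * T m)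

    limit-rate-nonneg : ∀ {u e} ((C , _) : Limit u e) → 0# ≤ C
    limit-rate-nonneg (C , u-e≪) = *-cancelˡ-≤ (0<T N₀)
      (≤-respˡ (sym (zeroʳ _)) (≤-respʳ (*-comm _ _) (≪-nonneg (u-e≪ N₀ ℕ.≤-refl))))

    limit-≪ : ∀ {u e r} ((C , _) : Limit u e) → (∀ m → u m ≪ r) → e ≪ r + C * T N₀
    limit-≪ {u} {e} (C , u-e≪) u≪r = ≪-resp (solveℂ 2 (λ u e → u ⊝ (u ⊝ e) ⊜ e) ℂᴿ.refl (u N₀) e)
      (≪-+ (u≪r N₀) (≪-neg (u-e≪ N₀ ℕ.≤-refl)))

    limit-* : ∀ {u e u′ e′ r} → (∀ m → u m ≪ r) → (∀ m → u′ m ≪ r) → Limit u e → Limit u′ e′ →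
              Limit (λ m → u m *ℂ u′ m) (e *ℂ e′)
    limit-* {u} {e} {u′} {e′} {r} u≪r u′≪r (C , u-e≪) l′@(C′ , u′-e′≪) = r * C′ + C * (r + C′ * T N₀) , λ m N₀≤m →
      ≪-weaken (≤-reflexive (solve 5
        (λ r C C′ t b → r :* (C′ :* t) :+ C :* t :* b := (r :* C′ :+ C :* b) :* t) refl r C C′ (T m)
        (r + C′ * T N₀)))
        (≪-resp (solveℂ 4 (λ u e u′ e′ → u ⊗ (u′ ⊝ e′) ⊕ (u ⊝ e) ⊗ e′ ⊜ u ⊗ u′ ⊝ e ⊗ e′) ℂᴿ.refl (u m) e (u′ m) e′)
          (≪-+ (≪-* (u≪r m) (u′-e′≪ m N₀≤m)) (≪-* (u-e≪ m N₀≤m) (limit-≪ l′ u′≪r))))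

    limit-- : ∀ {u e u′ e′} → Limit u e → Limit u′ e′ → Limit (λ m → u m +ℂ -ℂ u′ m) (e +ℂ -ℂ e′)
    limit-- {u} {e} {u′} {e′} (C , u-e≪) (C′ , u′-e′≪) = C + C′ , λ m N₀≤m →
      ≪-weaken (≤-reflexive (sym (distribʳ _ _ _)))
        (≪-resp (solveℂ 4 (λ u e u′ e′ → (u ⊝ e) ⊝ (u′ ⊝ e′) ⊜ (u ⊝ u′) ⊝ (e ⊝ e′)) ℂᴿ.refl (u m) e (u′ m) e′)
          (≪-+ (u-e≪ m N₀≤m) (≪-neg (u′-e′≪ m N₀≤m))))

    limit-perturb : ∀ {u u′ e C} → (∀ m → N₀ ℕ.≤ m → u m +ℂ -ℂ u′ m ≪ C * T m) → Limit u e → Limit u′ e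
    limit-perturb {u} {u′} {e} {C′} u-u′≪ (C , u-e≪) = C + C′ , λ m N₀≤m →
      ≪-weaken (≤-reflexive (sym (distribʳ _ _ _)))
        (≪-resp (solveℂ 3 (λ u e u′ → (u ⊝ e) ⊝ (u ⊝ u′) ⊜ u′ ⊝ e) ℂᴿ.refl (u m) e (u′ m))
          (≪-+ (u-e≪ m N₀≤m) (≪-neg (u-u′≪ m N₀≤m))))

    limit-lower : ∀ {u e r} → Limit u e → (∀ m → N₀ ℕ.≤ m → r ≤ im (u m)) → r ≤ im e
    limit-lower {u} {e} {r} l@(C , u-e≪) r≤ = ≤-by
      (x≤y⇒0≤y-x (vanishing (λ m N₀≤m → ≤-trans (+-mono-≤ (r≤ m N₀≤m) ≤-refl) (proj₂ (≪⇒im (u-e≪ m N₀≤m))))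
      (limit-rate-nonneg {u} {e} l)))
      (solve 2 (λ r e → e :- r := con (+ 0) :- (r :- e)) refl r (im e))

    -- The limit is the supremum of the left ends `u m - 2 T m` of the nested intervals; each right
    -- end `u n + 2 T n` is an upper bound for them, whichever of `m` and `n` is larger.
    nested-limit : ∀ (u : ℕ → Carrier) → (∀ m n → N₀ ℕ.≤ m → m ℕ.≤ n → Bounded (u n - u m) (2# * T m)) →
                   ∃[ l ] (∀ m → N₀ ℕ.≤ m → Bounded (u m - l) (2# * T m))
    nested-limit u near = l , λ m N₀≤m →
        ≤-by (x≤y⇒0≤y-x (least (u m + 2# * T m) (upper m N₀≤m)))
          (solve 3 (λ u l t → u :- l :- :- t := u :+ t :- l) refl (u m) l (2# * T m)) ,
        ≤-by (x≤y⇒0≤y-x (ub _ (m , N₀≤m , refl)))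
          (solve 3 (λ u l t → t :- (u :- l) := l :- (u :- t)) refl (u m) l (2# * T m))
      where
      P : Carrier → Set
      P y = ∃[ m ] (N₀ ℕ.≤ m × y ≈ u m - 2# * T m)
      upper : ∀ n → N₀ ℕ.≤ n → IsUpperBound P (u n + 2# * T n)
      upper n N₀≤n y (m , N₀≤m , y≈) with ℕ.≤-total m n
      ... | inj₁ m≤n = ≤-by (0≤+ (x≤y⇒0≤y-x (proj₁ (near m n N₀≤m m≤n))) (0≤* (<⇒≤ 0<2) (0≤T n)))
        (trans (+-congˡ (-‿cong y≈)) (solve 4 (λ u t u′ t′ → u′ :+ t′ :- (u :- t) := u′ :- u :- :- t :+ t′) refl
          (u m) (2# * T m) (u n) (2# * T n)))
      ... | inj₂ n≤m = ≤-by (0≤+ (x≤y⇒0≤y-x (proj₂ (near n m N₀≤n n≤m))) (0≤* (<⇒≤ 0<2) (0≤T m)))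
        (trans (+-congˡ (-‿cong y≈)) (solve 4 (λ u t u′ t′ → u′ :+ t′ :- (u :- t) := t′ :- (u :- u′) :+ t) refl
          (u m) (2# * T m) (u n) (2# * T n)))
      supremum = complete P (_ , N₀ , ℕ.≤-refl , refl) (_ , upper N₀ ℕ.≤-refl)
      l = proj₁ supremum
      ub : IsUpperBound P l
      ub = proj₁ (proj₂ supremum)
      least : ∀ c → IsUpperBound P c → l ≤ c
      least = proj₂ (proj₂ supremum)

    -- Existence of `exp (i x)` and its addition theorem.

    S : Carrier → ℕ → ℂ
    S x = expPartialSum (0# +i x)

    Cis : Carrier → ℂ → Set
    Cis x = Limit (S x)

    cisTerm-≪ : ∀ {x} → Bounded x X → ∀ k → termℂ (0# +i x) k ≪ term X k
    cisTerm-≪ x≤X = termℂ-≪ (≪-imaginary x≤X)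

    term≤T : ∀ k → term X k ≤ T k
    term≤T = term-mono-≤ 0≤X (≤-respˡ (+-identityʳ X) (+-mono-≤ ≤-refl 0≤X))

    S-≪ : ∀ {x} → Bounded x X → ∀ m → S x m ≪ L
    S-≪ x≤X m = ≪-weaken (Σ≤L m) (Σ-≪ m (λ k → ≪-weaken (term≤T k) (cisTerm-≪ x≤X k)))

    S-cauchy : ∀ {x m n} → Bounded x X → N₀ ℕ.≤ m → m ℕ.≤ n → S x n +ℂ -ℂ S x m ≪ 2# * T m
    S-cauchy x≤X N₀≤m m≤n = ≪-weaken (tail-≤ N₀≤m m≤n)
      (Σ-segment-≪ m≤n (λ k → ≪-weaken (term≤T k) (cisTerm-≪ x≤X k)))

    cis-exists : ∀ {x} → Bounded x X → ∃[ e ] Cis x e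
    cis-exists {x} x≤X =
      let c , S→c = nested-limit (re ∘ S x) (λ m n N₀≤m m≤n → ≪⇒re (S-cauchy x≤X N₀≤m m≤n))
          s , S→s = nested-limit (im ∘ S x) (λ m n N₀≤m m≤n → ≪⇒im (S-cauchy x≤X N₀≤m m≤n))
      in c +i s , 2# + 2# , λ m N₀≤m →
      majorant (S→c m N₀≤m) (S→s m N₀≤m) (≤-reflexive (sym (distribʳ _ _ _)))

    bounded-limit : ∀ {d r} → (∀ ε → 0# < ε → Bounded d (r + ε)) → Bounded d r
    bounded-limit {d} {r} near = lower , upper
      where
      lower : - r ≤ d
      lower with ≤∨> (- r) d
      ... | inj₁ -r≤d = -r≤d
      ... | inj₂ d<-r = ⊥-elim (≤⇒≯ (proj₁ (near ε 0<ε)) (<-by 0<ε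
          (trans (solve 3 (λ r d e → :- (r :+ e) :- d := :- r :- d :- e) refl r d ε)
            (trans (+-congʳ (sym (*/-cancel { - r - d} 0<2))) (solve 1 (λ e → con (+ 2) :* e :- e := e) refl ε)))))
        where
        ε = (- r - d) / 2#
        0<ε = 0</ (x<y⇒0<y-x d<-r) 0<2
      upper : d ≤ r
      upper with ≤∨> d r
      ... | inj₁ d≤r = d≤r
      ... | inj₂ r<d = ⊥-elim (≤⇒≯ (proj₂ (near ε 0<ε)) (<-by 0<ε
          (trans (solve 3 (λ r d e → d :- (r :+ e) := d :- r :- e) refl r d ε)
            (trans (+-congʳ (sym (*/-cancel {d - r} 0<2))) (solve 1 (λ e → con (+ 2) :* e :- e := e) refl ε)))))
        where
        ε = (d - r) / 2#
        0<ε = 0</ (x<y⇒0<y-x r<d) 0<2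

    -- The unknown modulus of convergence is traded for the rate `T`: for fixed `m`, the sum at `m`
    -- is within `2 T m` of a later sum that is within `ε` of `e`, and `ε` is arbitrary.
    isCis⇒cis : ∀ {x e} → Bounded x X → IsCis x e → Cis x e
    isCis⇒cis {x} {e} x≤X S→e = 2# + 2# , λ m N₀≤m → majorant
        (bounded-limit (λ ε 0<ε → let M , close = S→e ε 0<ε ; n = M ℕ.⊔ m in
          bounded-resp (cancel (re (S x n)) (re (S x m)) (re e))
            (bounded-+ (bounded-neg (≪⇒re (S-cauchy x≤X N₀≤m (ℕ.m≤n⊔m M m))))
                       (sq<⇒bounded 0<ε (close n (ℕ.m≤m⊔n M m))))))
        (bounded-limit (λ ε 0<ε → let M , close = S→e ε 0<ε ; n = M ℕ.⊔ m in
          bounded-resp (cancel (im (S x n)) (im (S x m)) (im e))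
            (bounded-+ (bounded-neg (≪⇒im (S-cauchy x≤X N₀≤m (ℕ.m≤n⊔m M m))))
                       (sq<⇒bounded 0<ε (<-respˡ (+-comm _ _) (close n (ℕ.m≤m⊔n M m)))))))
        (≤-reflexive (sym (distribʳ _ _ _)))
      where
      cancel : ∀ u v e → - (u - v) + (u - e) ≈ v - e
      cancel = solve 3 (λ u v e → :- (u :- v) :+ (u :- e) := v :- e) refl

    normSq-≤ : ∀ {z r} → z ≪ r → normSq z ≤ r * r
    normSq-≤ (majorant {A} {B} a b A+B≤r) = ≤-trans
      (≤-by (0≤+ (0≤+ (x≤y⇒0≤y-x (proj₂ (bounded-* a a))) (x≤y⇒0≤y-x (proj₂ (bounded-* b b))))
        (0≤* (0≤+ 0≤A 0≤A) 0≤B))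
        (solve 4 (λ A B p q → (A :+ B) :* (A :+ B) :- (p :+ q) := A :* A :- p :+ (B :* B :- q) :+
          (A :+ A) :* B) refl A B _ _))
      (*-mono-≤ (0≤+ 0≤A 0≤B) (≤-trans (0≤+ 0≤A 0≤B) A+B≤r) A+B≤r A+B≤r)
      where
      0≤A = bounded-nonneg a
      0≤B = bounded-nonneg b

    cis⇒isCis : ∀ {x e} → Cis x e → IsCis x e
    cis⇒isCis {x} {e} l@(C , S-e≪) ε 0<ε =
      let M , N₀≤M , small = T→0 (limit-rate-nonneg {S x} {e} l) 0<ε in M , λ m M≤m →
      ≤-<-trans (normSq-≤ (S-e≪ m (ℕ.≤-trans N₀≤M M≤m)))
        (≤-<-trans (*-monoˡ-≤ (≪-nonneg (S-e≪ m (ℕ.≤-trans N₀≤M M≤m))) (<⇒≤ (small m M≤m)))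
          (<-respˡ (*-comm _ _) (*-monoˡ-< 0<ε (small m M≤m))))

    expSequenceℂ-resp : ∀ {z w f} → z ≈ℂ w → IsExpSequenceℂ z f → IsExpSequenceℂ w f
    expSequenceℂ-resp {f = f} z≈w (f0 , f⁺) = f0 , λ k → ℂᴿ.trans (f⁺ k) (ℂᴿ.*-congʳ {f k} z≈w)

    -- The product of the partial sums at `m` differs from the partial sum for `x + y` by terms
    -- outside the triangle. Their majorant is `(Σ (term X) m)² - Σ T m`, at most
    -- `Σ T (m + m) - Σ T m`, which is a tail of the series `T`.
    cis-+ : ∀ {x y e e′} → Bounded x X → Bounded y X → Cis x e → Cis y e′ → Cis (x + y) (e *ℂ e′)
    cis-+ {x} {y} {e} {e′} x≤X y≤X S→e S→e′ = limit-perturb {λ m → S x m *ℂ S y m} {S (x + y)} {e *ℂ e′} {2#}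
      (λ m N₀≤m →
        ≪-resp (ℂᴿ.+-congˡ {S x m *ℂ S y m} (ℂᴿ.-‿cong (Σℂ-cong m product)))
          (≪-weaken (≤-trans (+-mono-≤ (Σ-conv-grow m m (term-nonneg 0≤X) (term-nonneg 0≤X)) ≤-refl)
              (≤-trans (≤-reflexive (+-cong (Σ-cong (m ℕ.+ m) real-product) (-‿cong (Σ-cong m real-product))))
                (tail-≤ N₀≤m (ℕ.m≤m+n m m))))
            (cauchy-≪ {m = m} ℕ.≤-refl (cisTerm-≪ x≤X) (cisTerm-≪ y≤X))))
        (limit-* {S x} {e} {S y} {e′} (S-≪ x≤X) (S-≪ y≤X) S→e S→e′)
      where
      product : ∀ k → convℂ (termℂ (0# +i x)) (termℂ (0# +i y)) k ≈ℂ termℂ (0# +i (x + y)) k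
      product = expSequence-uniqueℂ
        (expSequenceℂ-resp (+-identityˡ 0# , refl)
        (conv-expSequenceℂ (termℂ-isExpSequence (0# +i x)) (termℂ-isExpSequence (0# +i y))))
        (termℂ-isExpSequence (0# +i (x + y)))
      real-product : ∀ k → conv (term X) (term X) k ≈ T k
      real-product = expSequence-unique (conv-expSequence (term-isExpSequence X) (term-isExpSequence X))
        (term-isExpSequence (X + X))

    -- Lipschitz bound and positivity of the sine.

    ^-diff-≪ : ∀ {z w d} k → z ≪ X → w ≪ X → z +ℂ -ℂ w ≪ d →
               (z ^ℂ suc k) +ℂ -ℂ (w ^ℂ suc k) ≪ fromNat (suc k) * (d * X ^ k)
    ^-diff-≪ {z} {w} {d} zero    z≪X w≪X z-w≪d = ≪-weaken
      (≤-reflexive (solve 1 (λ d → d := (con (+ 1) :+ con (+ 0)) :* (d :* con (+ 1))) refl d))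
      (≪-resp (solveℂ 2 (λ z w → z ⊝ w ⊜ z ⊗ conℂ (+ 1) ⊝ w ⊗ conℂ (+ 1)) ℂᴿ.refl z w) z-w≪d)
    ^-diff-≪ {z} {w} {d} (suc k) z≪X w≪X z-w≪d = ≪-weaken
      (≤-reflexive (solve 4 (λ X m d p → X :* ((con (+ 1) :+ m) :* (d :* p)) :+ d :* (X :* p) :=
        (con (+ 1) :+ (con (+ 1) :+ m)) :* (d :* (X :* p))) refl X (fromNat k) d (X ^ k)))
      (≪-resp (solveℂ 4 (λ z w p q → z ⊗ (p ⊝ q) ⊕ (z ⊝ w) ⊗ q ⊜ z ⊗ p ⊝ w ⊗ q) ℂᴿ.refl z w (z ^ℂ suc k)
        (w ^ℂ suc k))
        (≪-+ (≪-* z≪X (^-diff-≪ k z≪X w≪X z-w≪d)) (≪-* z-w≪d (≪-^ (suc k) w≪X))))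

    Σ-diff-≪ : ∀ {f g α} m → (∀ k → f k +ℂ -ℂ g k ≪ α k) → Σℂ f m +ℂ -ℂ Σℂ g m ≪ Σ α m
    Σ-diff-≪ zero    f-g≪α = ≪-resp (solveℂ 0 (conℂ (+ 0) ⊜ conℂ (+ 0) ⊝ conℂ (+ 0)) ℂᴿ.refl) ≪-0
    Σ-diff-≪ {f} {g} (suc m) f-g≪α = ≪-resp
      (solveℂ 4 (λ x y s t → (x ⊝ y) ⊕ (s ⊝ t) ⊜ (x ⊕ s) ⊝ (y ⊕ t)) ℂᴿ.refl (f 0) (g 0) (Σℂ (f ∘ suc) m)
        (Σℂ (g ∘ suc) m))
      (≪-+ (f-g≪α 0) (Σ-diff-≪ m (f-g≪α ∘ suc)))

    Σ-scale : ∀ d f m → Σ (λ k → d * f k) m ≈ d * Σ f m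
    Σ-scale d f zero    = sym (zeroʳ d)
    Σ-scale d f (suc m) = trans (+-congˡ (Σ-scale d (f ∘ suc) m)) (sym (distribˡ d (f 0) (Σ (f ∘ suc) m)))

    Σ-term≤L : ∀ m → Σ (term X) m ≤ L
    Σ-term≤L m = ≤-trans (Σ-mono-≤ m term≤T) (Σ≤L m)

    -- The exponential series is its own derivative: the terms of index `k + 1` differ by at most `d
    -- (k + 1) X ^ k / (k + 1)! = d X ^ k / k!`, and the constant terms cancel.
    S-lipschitz : ∀ {x y d} → Bounded x X → Bounded y X → Bounded (x - y) d → ∀ m → S x m +ℂ -ℂ S y m ≪ d * L
    S-lipschitz {x} {y} {d} x≤X y≤X x-y≤d zero = ≪-weaken (0≤* (bounded-nonneg x-y≤d) (<⇒≤ 0<L))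
      (≪-resp (ℂᴿ.sym (ℂᴿ.-‿inverseʳ 0ℂ)) ≪-0)
    S-lipschitz {x} {y} {d} x≤X y≤X x-y≤d (suc m) = ≪-weaken
      (≤-trans (≤-reflexive (trans (+-identityˡ _) (Σ-scale d (term X) m)))
        (*-monoˡ-≤ (bounded-nonneg x-y≤d) (Σ-term≤L m)))
      (Σ-diff-≪ (suc m) term-diff)
      where
      z w : ℂ
      z = 0# +i x
      w = 0# +i y
      z-w≪d : z +ℂ -ℂ w ≪ d
      z-w≪d = ≪-resp (sym (-‿inverseʳ 0#) , refl) (≪-imaginary x-y≤d)
      α : ℕ → Carrier
      α zero    = 0#
      α (suc k) = d * term X k
      term-diff : ∀ k → termℂ z k +ℂ -ℂ termℂ w k ≪ α k
      term-diff zero    = ≪-resp (ℂᴿ.sym (ℂᴿ.-‿inverseʳ (termℂ z 0))) ≪-0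
      term-diff (suc k) = ≪-weaken
        (≤-reflexive (trans (solve 4 (λ i m d p → i :* (m :* (d :* p)) := d :* (m :* i :* p)) refl
          (fromNat (suc k !) ⁻¹) (fromNat (suc k)) d (X ^ k))
          (*-congˡ (*-congʳ (factorial-inverse k)))))
        (≪-resp (solveℂ 3 (λ i p q → i ⊗ (p ⊝ q) ⊜ i ⊗ p ⊝ i ⊗ q) ℂᴿ.refl (ofReal (fromNat (suc k !) ⁻¹))
          (z ^ℂ suc k) (w ^ℂ suc k))
          (≪-* (≪-ofReal (nonneg⇒bounded (<⇒≤ (0<⁻¹ (factorial-pos (suc k)))) ≤-refl))
            (^-diff-≪ k (≪-imaginary x≤X) (≪-imaginary y≤X) z-w≪d)))

    sin-lipschitz : ∀ {x y d e e′} → Bounded x X → Bounded y X → Bounded (x - y) d → Cis x e → Cis y e′ →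
                    Bounded (im e - im e′) (d * L)
    sin-lipschitz {x} {y} {d} {e} {e′} x≤X y≤X x-y≤d S→e S→e′ =
      lower x≤X y≤X x-y≤d S→e S→e′ ,
      ≤-by (x≤y⇒0≤y-x (lower y≤X x≤X (bounded-resp (solve 2 (λ x y → :- (x :- y) := y :- x) refl x y)
        (bounded-neg x-y≤d)) S→e′ S→e))
        (solve 3 (λ e e′ r → r :- (e :- e′) := (e′ :- e) :- :- r) refl (im e) (im e′) (d * L))
      where
      lower : ∀ {x y e e′} → Bounded x X → Bounded y X → Bounded (x - y) d → Cis x e → Cis y e′ → -
        (d * L) ≤ im e - im e′
      lower {x} {y} {e} {e′} x≤X y≤X x-y≤d S→e S→e′ =
        limit-lower {λ m → S x m +ℂ -ℂ S y m} {e +ℂ -ℂ e′} (limit-- {S x} {e} {S y} {e′} S→e S→e′)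
          (λ m _ → proj₁ (≪⇒im (S-lipschitz x≤X y≤X x-y≤d m)))

    factorial⁻¹-decreasing : ∀ k → fromNat (suc k !) ⁻¹ ≤ fromNat (k !) ⁻¹
    factorial⁻¹-decreasing k = ≤-respʳ (factorial-inverse k) (≤-respˡ (*-identityˡ _)
      (*-monoʳ-≤ (<⇒≤ (0<⁻¹ (factorial-pos (suc k))))
        (≤-respˡ (+-identityʳ 1#) (+-mono-≤ ≤-refl (fromNat-nonneg k)))))

    -- The terms of index 0 and 1 contribute exactly `x` to the imaginary part. Since
    -- `1 / (k + 2)! ≤ 1 / k!`, the later terms are at most `x²` times the terms for `X`, which sum
    -- to at most `L`. This crude error suffices for positivity near 0.
    sin-lower : ∀ {x e} → 0# ≤ x → x ≤ X → Cis x e → x - x * x * L ≤ im e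
    sin-lower {x} {e} 0≤x x≤X S→e = limit-lower {S x} {e} S→e λ m N₀≤m →
        ≡.subst (λ m → x - x * x * L ≤ im (S x m)) (ℕ.m+[n∸m]≡n (ℕ.≤-trans 2≤N₀ N₀≤m)) (partial (m ℕ.∸ 2))
      where
      z : ℂ
      z = 0# +i x
      termℂ-tail : ∀ k → termℂ z (2 ℕ.+ k) ≪ x * x * term X k
      termℂ-tail k = ≪-weaken
        (≤-trans (*-mono-≤ (<⇒≤ (0<⁻¹ (factorial-pos (2 ℕ.+ k)))) (0≤* 0≤x (0≤* 0≤x (^-nonneg k 0≤X)))
                   (≤-trans (factorial⁻¹-decreasing (suc k)) (factorial⁻¹-decreasing k))
                   (*-monoˡ-≤ 0≤x (*-monoˡ-≤ 0≤x (^-mono-≤ k 0≤x x≤X))))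
          (≤-reflexive (solve 3 (λ i x p → i :* (x :* (x :* p)) := x :* x :* (i :* p)) refl (fromNat (k !) ⁻¹) x
            (X ^ k))))
        (termℂ-≪ (≪-imaginary (nonneg⇒bounded 0≤x ≤-refl)) (2 ℕ.+ k))
      partial : ∀ k → x - x * x * L ≤ im (S x (2 ℕ.+ k))
      partial k = ≤-by
        (0≤+ (x≤y⇒0≤y-x (proj₁ (≪⇒im (Σ-≪ k termℂ-tail))))
             (≤-trans (0≤* (0≤x*x x) (x≤y⇒0≤y-x (Σ-term≤L k)))
               (≤-reflexive (trans (solve 3 (λ x s L → x :* x :* (L :- s) := x :* x :* L :- x :* x :* s) refl x
               (Σ (term X) k) L)
                (+-congˡ (-‿cong (sym (Σ-scale (x * x) (term X) k))))))))
        (trans (+-congʳ first-terms)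
          (solve 4 (λ x r s t → x :+ t :- (x :- r) := t :- :- s :+ (r :- s)) refl x (x * x * L)
            (Σ (λ k → x * x * term X k) k) (im (Σℂ (λ i → termℂ z (2 ℕ.+ i)) k))))
        where
        first-terms : im (S x (2 ℕ.+ k)) ≈ x + im (Σℂ (λ i → termℂ z (2 ℕ.+ i)) k)
        first-terms = trans
          (solve 4 (λ i j x t → (i :* con (+ 0) :+ con (+ 0) :* con (+ 1)) :+
              ((j :* (con (+ 0) :* con (+ 0) :+ x :* con (+ 1)) :+ con (+ 0) :*
                (con (+ 0) :* con (+ 1) :- x :* con (+ 0))) :+ t) := j :* x :+ t) refl
            (fromNat (0 !) ⁻¹) (fromNat (1 !) ⁻¹) x (im (Σℂ (λ i → termℂ z (2 ℕ.+ i)) k)))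
          -- Both `0 !` and `1 !` reduce to `1`, so `0!⁻¹≈1` also evaluates the coefficient of the
          -- linear term.
          (+-congʳ (trans (*-congʳ 0!⁻¹≈1) (*-identityˡ x)))

    -- A first sign change of sin inside (0, X) would be a zero.
    sin-pos : (∀ x → 0# < x → x < X → ∀ e → IsCis x e → ¬ im e ≈ 0#) →
              ∀ {x e} → 0# < x → x < X → Cis x e → 0# < im e
    sin-pos sin≉0 {x} {e} 0<x x<X S→e with ≤∨> (im e) 0#
    ... | inj₂ 0<im = 0<im
    ... | inj₁ im≤0 = ⊥-elim (sin≉0 y (<-≤-trans 0<h h≤y) (≤-<-trans y≤x x<X) _
      (cis⇒isCis (proj₂ (cis-exists (inside h≤y y≤x)))) zero-at-y)
      where
      -- For `0 < y ≤ h` the lower bound is `y (1 - y L) ≥ y / 2 > 0`. The search for a zero starts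
      -- at `h` because the sine vanishes at 0 itself, while `intermediate-value` needs a positive
      -- value at the left end.
      h = 1# / (2# * L)
      0<2L : 0# < 2# * L
      0<2L = *-pos 0<2 0<L
      0<h : 0# < h
      0<h = 0</ 0<1 0<2L
      0<hL : 0# < h * L
      0<hL = *-pos 0<h 0<L
      1-hL : 1# - h * L ≈ h * L
      1-hL = trans (+-congʳ (sym (*/-cancel 0<2L)))
        (solve 2 (λ h L → con (+ 2) :* L :* h :- h :* L := h :* L) refl h L)
      positive : ∀ {y e} → 0# < y → y ≤ X → y ≤ h → Cis y e → 0# < im e
      positive {y} {e} 0<y y≤X y≤h S→e = <-≤-trans
        (<-respʳ (trans (*-congˡ (+-congʳ (sym 1-hL)))
          (solve 3 (λ y h L → y :* (con (+ 1) :- h :* L :+ (h :- y) :* L) := y :- y :* y :* L) refl y h L))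
          (*-pos 0<y (0<+ 0<hL (0≤* (x≤y⇒0≤y-x y≤h) (<⇒≤ 0<L)))))
        (sin-lower {y} {e} (<⇒≤ 0<y) y≤X S→e)
      h≤x : h ≤ x
      h≤x with ≤∨> h x
      ... | inj₁ h≤x = h≤x
      ... | inj₂ x<h = ⊥-elim (≤⇒≯ im≤0 (positive {x} {e} 0<x (<⇒≤ x<X) (<⇒≤ x<h) S→e))
      inside : ∀ {y} → h ≤ y → y ≤ x → Bounded y X
      inside h≤y y≤x = nonneg⇒bounded (≤-trans (<⇒≤ 0<h) h≤y) (≤-trans y≤x (<⇒≤ x<X))
      sin : ∀ y → h ≤ y → y ≤ x → Carrier
      sin y h≤y y≤x = im (proj₁ (cis-exists (inside h≤y y≤x)))
      sin-bounded : ∀ {y y′} (hy : h ≤ y) (yx : y ≤ x) (hy′ : h ≤ y′) (y′x : y′ ≤ x) → y ≤ y′ →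
                    Bounded (sin y hy yx - sin y′ hy′ y′x) (L * (y′ - y))
      sin-bounded {y} {y′} hy yx hy′ y′x y≤y′ = bounded-weaken (≤-reflexive (*-comm _ _))
        (sin-lipschitz {y} {y′} {y′ - y} {proj₁ (cis-exists (inside hy yx))}
          {proj₁ (cis-exists (inside hy′ y′x))} (inside hy yx) (inside hy′ y′x)
          (≤-reflexive (solve 2 (λ y y′ → :- (y′ :- y) := y :- y′) refl y y′) ,
           ≤-by (0≤+ (x≤y⇒0≤y-x y≤y′) (x≤y⇒0≤y-x y≤y′))
             (solve 2 (λ y y′ → y′ :- y :- (y :- y′) := (y′ :- y) :+ (y′ :- y)) refl y y′))
          (proj₂ (cis-exists (inside hy yx))) (proj₂ (cis-exists (inside hy′ y′x))))
      -- The value that `cis-exists` selects at `x` is not `e` by definition; `sin-lipschitz` at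
      -- distance 0 identifies the two imaginary parts.
      sin[x]≤0 : sin x h≤x ≤-refl ≤ 0#
      sin[x]≤0 = ≤-trans (≤-by (x≤y⇒0≤y-x
        (proj₁ (sin-lipschitz {x} {x} {0#} {e} {proj₁ (cis-exists (inside h≤x ≤-refl))} (inside h≤x ≤-refl)
        (inside h≤x ≤-refl) (bounded-resp (sym (-‿inverseʳ x)) bounded-0) S→e
        (proj₂ (cis-exists (inside h≤x ≤-refl))))))
          (solve 3 (λ s s′ L → s :- s′ := s :- s′ :- :- (con (+ 0) :* L)) refl (im e) (sin x h≤x ≤-refl) L)) im≤0
      root = intermediate-value sin 0<L sin-bounded h≤x
        (positive 0<h (≤-trans h≤x (<⇒≤ x<X)) ≤-refl (proj₂ (cis-exists (inside ≤-refl h≤x)))) sin[x]≤0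
      y = proj₁ root
      h≤y = proj₁ (proj₂ root)
      y≤x = proj₁ (proj₂ (proj₂ root))
      zero-at-y : sin y h≤y y≤x ≈ 0#
      zero-at-y = proj₂ (proj₂ (proj₂ root))

    -- The rotation g by (X - n φ) / 2 moves all the angles 0, φ, …, n φ into (0, X).
    rotation : (∀ x → 0# < x → x < X → ∀ e → IsCis x e → ¬ im e ≈ 0#) →
               ∀ n {φ e} → Bounded φ X → - X < fromNat n * φ → fromNat n * φ < X → IsCis φ e →
               ∃[ g ] (∀ m → m ℕ.≤ n → 0# < im (g *ℂ (e ^ℂ m)))
    rotation sin≉0 n {φ} {e} φ≤X -X<nφ nφ<X S→e = g , λ m m≤n →
        sin-pos sin≉0 {angle m} {g *ℂ (e ^ℂ m)} (angle-pos m (n ℕ.∸ m) (ℕ.m+[n∸m]≡n m≤n))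
          (angle-<X m (n ℕ.∸ m) (ℕ.m+[n∸m]≡n m≤n)) (cis-angle m m≤n)
      where
      -- The first and the last angle add up to `X`, so the progression is centred at `X / 2` and
      -- spans less than `X`. Adding `φ` at each step parallels multiplying by `e` in `cis-angle`.
      angle : ℕ → Carrier
      angle zero    = (X - fromNat n * φ) / 2#
      angle (suc m) = angle m + φ
      2*angle : ∀ m → 2# * angle m ≈ X - fromNat n * φ + 2# * (fromNat m * φ)
      2*angle zero    = trans (*/-cancel 0<2) (solve 2 (λ p φ → p := p :+ con (+ 2) :* (con (+ 0) :* φ)) refl
        (X - fromNat n * φ) φ)
      2*angle (suc m) = trans (distribˡ 2# (angle m) φ) (trans (+-congʳ (2*angle m))
        (solve 3 (λ p m φ → p :+ con (+ 2) :* (m :* φ) :+ con (+ 2) :* φ := p :+ con (+ 2) :*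
          ((con (+ 1) :+ m) :* φ)) refl (X - fromNat n * φ) (fromNat m) φ))
      split : ∀ m k → m ℕ.+ k ≡.≡ n → fromNat n ≈ fromNat m + fromNat k
      split m k ≡.refl = ×-homo-+ 1# m k
      cancel-2 : ∀ {x t} → 0# < t → 2# * x ≈ t → 0# < x
      cancel-2 0<t 2x≈t = *-cancelˡ-< 0<2 (<-respˡ (sym (zeroʳ 2#)) (<-respʳ (sym 2x≈t) 0<t))
      0≤2*mφ : 0# ≤ φ → ∀ m → 0# ≤ 2# * (fromNat m * φ)
      0≤2*mφ 0≤φ m = 0≤* (<⇒≤ 0<2) (0≤* (fromNat-nonneg m) 0≤φ)
      0≤-2*mφ : φ < 0# → ∀ m → 0# ≤ 2# * (fromNat m * - φ)
      0≤-2*mφ φ<0 m = 0≤* (<⇒≤ 0<2)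
        (0≤* (fromNat-nonneg m) (≤-respˡ (solve 0 (:- con (+ 0) := con (+ 0)) refl) (neg-mono-≤ (<⇒≤ φ<0))))
      angle-pos : ∀ m k → m ℕ.+ k ≡.≡ n → 0# < angle m
      angle-pos m k m+k≡n with ≤∨> 0# φ
      ... | inj₁ 0≤φ = cancel-2 (0<+ (x<y⇒0<y-x nφ<X) (0≤2*mφ 0≤φ m)) (2*angle m)
      -- For negative `φ` the last angle is the smallest, and twice it is `X + n φ > 0`; `angle m`
      -- lies `k` steps of `- φ` above it.
      ... | inj₂ φ<0 = cancel-2 (0<+ (x<y⇒0<y-x -X<nφ) (0≤-2*mφ φ<0 k)) (trans (2*angle m)
        (trans (+-congʳ (+-congˡ (-‿cong (*-congʳ (split m k m+k≡n))))) (trans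
          (solve 4 (λ X m k φ → X :- (m :+ k) :* φ :+ con (+ 2) :* (m :* φ) :=
            (m :+ k) :* φ :- :- X :+ con (+ 2) :* (k :* :- φ)) refl X (fromNat m) (fromNat k) φ)
          (+-congʳ (+-congʳ (*-congʳ (sym (split m k m+k≡n))))))))
      2*[X-angle] : ∀ m → 2# * (X - angle m) ≈ X + fromNat n * φ - 2# * (fromNat m * φ)
      2*[X-angle] m = trans (solve 2 (λ X a → con (+ 2) :* (X :- a) := con (+ 2) :* X :- con (+ 2) :* a) refl X
        (angle m))
        (trans (+-congˡ (-‿cong (2*angle m)))
          (solve 3 (λ X p q → con (+ 2) :* X :- (X :- p :+ q) := X :+ p :- q) refl X (fromNat n * φ)
          (2# * (fromNat m * φ))))
      angle-<X : ∀ m k → m ℕ.+ k ≡.≡ n → angle m < X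
      angle-<X m k m+k≡n with ≤∨> 0# φ
      ... | inj₂ φ<0 = <-by (cancel-2 (0<+ (x<y⇒0<y-x -X<nφ) (0≤-2*mφ φ<0 m)) (trans (2*[X-angle] m)
            (solve 4 (λ X p m φ → X :+ p :- con (+ 2) :* (m :* φ) := p :- :- X :+ con (+ 2) :*
              (m :* :- φ)) refl X (fromNat n * φ) (fromNat m) φ))) refl
      ... | inj₁ 0≤φ = <-by (cancel-2 (0<+ (x<y⇒0<y-x nφ<X) (0≤2*mφ 0≤φ k)) (trans (2*[X-angle] m)
        (trans (+-congʳ (+-congˡ (*-congʳ (split m k m+k≡n)))) (trans
          (solve 4 (λ X m k φ → X :+ (m :+ k) :* φ :- con (+ 2) :* (m :* φ) := X :-
            (m :+ k) :* φ :+ con (+ 2) :* (k :* φ)) refl X (fromNat m) (fromNat k) φ)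
          (+-congʳ (+-congˡ (-‿cong (*-congʳ (sym (split m k m+k≡n)))))))))) refl
      angle-bounded : ∀ m → m ℕ.≤ n → Bounded (angle m) X
      angle-bounded m m≤n = nonneg⇒bounded (<⇒≤ (angle-pos m (n ℕ.∸ m) (ℕ.m+[n∸m]≡n m≤n)))
        (<⇒≤ (angle-<X m (n ℕ.∸ m) (ℕ.m+[n∸m]≡n m≤n)))
      g : ℂ
      g = proj₁ (cis-exists (angle-bounded 0 ℕ.z≤n))
      limit-resp : ∀ {u e e′} → e ≈ℂ e′ → Limit u e → Limit u e′
      limit-resp {u} e≈e′ (C , u-e≪) = C , λ m N₀≤m → ≪-resp (ℂᴿ.+-congˡ {u m} (ℂᴿ.-‿cong e≈e′)) (u-e≪ m N₀≤m)
      cis-angle : ∀ m → m ℕ.≤ n → Cis (angle m) (g *ℂ (e ^ℂ m))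
      cis-angle zero    m≤n = limit-resp {S (angle 0)} {g} (ℂᴿ.sym (ℂᴿ.*-identityʳ g))
        (proj₂ (cis-exists (angle-bounded 0 ℕ.z≤n)))
      cis-angle (suc m) m<n = limit-resp {S (angle (suc m))} {(g *ℂ (e ^ℂ m)) *ℂ e}
        (solveℂ 3 (λ g p e → g ⊗ p ⊗ e ⊜ g ⊗ (e ⊗ p)) ℂᴿ.refl g (e ^ℂ m) e)
        (cis-+ {angle m} {φ} {g *ℂ (e ^ℂ m)} {e} (angle-bounded m (ℕ.<⇒≤ m<n)) φ≤X (cis-angle m (ℕ.<⇒≤ m<n))
          (isCis⇒cis φ≤X S→e))

-- Grouping of lists into alternating runs.

module _ {a} {A : Set a} where

  -- The left and right groups alternate, and the first one is a left group
  -- exactly when the index is true.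
  data Alternating : Bool → List (List⁺ A ⊎ List⁺ A) → Set a where
    []   : ∀ {b} → Alternating b []
    inˡ_ : ∀ {xs gs} → Alternating false gs → Alternating true (inj₁ xs ∷ gs)
    inʳ_ : ∀ {xs gs} → Alternating true gs → Alternating false (inj₂ xs ∷ gs)

  groupSeqs-alternating : ∀ {p} {P : Pred A p} (P? : Decidable P) x xs → Alternating (does (P? x))
    (groupSeqs P? (x ∷ xs))
  groupSeqs-alternating P? x [] with does (P? x)
  ... | true  = inˡ []
  ... | false = inʳ []
  groupSeqs-alternating P? x (y ∷ ys) with does (P? x) | does (P? y) | groupSeqs P?
    (y ∷ ys) | groupSeqs-alternating P? y ys
  ... | true  | b     | []         | _     = inˡ []
  ... | true  | true  | inj₁ _ ∷ _ | inˡ h = inˡ h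
  ... | true  | false | inj₂ _ ∷ _ | inʳ h = inˡ (inʳ h)
  ... | false | b     | []         | _     = inʳ []
  ... | false | true  | inj₁ _ ∷ _ | inˡ h = inʳ (inˡ h)
  ... | false | false | inj₂ _ ∷ _ | inʳ h = inʳ h

  length-groupSeqs-change : ∀ {p} {P : Pred A p} (P? : Decidable P) x xs →
                            length (groupSeqs P? (x ∷ xs)) ℕ.≤ suc (length (groupSeqs P? xs))
  length-groupSeqs-change P? x xs with does (P? x) | groupSeqs P? xs
  ... | true  | []         = ℕ.≤-refl
  ... | true  | inj₁ _ ∷ _ = ℕ.n≤1+n _
  ... | true  | inj₂ _ ∷ _ = ℕ.≤-refl
  ... | false | []         = ℕ.≤-refl
  ... | false | inj₁ _ ∷ _ = ℕ.≤-refl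
  ... | false | inj₂ _ ∷ _ = ℕ.n≤1+n _

  length-groupSeqs-same : ∀ {p} {P : Pred A p} (P? : Decidable P) x y ys → does (P? x) ≡ does (P? y) →
                          length (groupSeqs P? (x ∷ y ∷ ys)) ℕ.≤ length (groupSeqs P? (y ∷ ys))
  length-groupSeqs-same P? x y ys with does (P? x) | does (P? y) | groupSeqs P?
    (y ∷ ys) | groupSeqs-alternating P? y ys | groupSeqs-nonempty
    where
    -- Abstracted together with the groups, this excludes the empty list, which `Alternating` admits
    -- for either index.
    groupSeqs-nonempty : 1 ℕ.≤ length (groupSeqs P? (y ∷ ys))
    groupSeqs-nonempty with does (P? y) | groupSeqs P? ys
    ... | true  | []         = s≤s z≤n
    ... | true  | inj₁ _ ∷ _ = s≤s z≤n
    ... | true  | inj₂ _ ∷ _ = s≤s z≤n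
    ... | false | []         = s≤s z≤n
    ... | false | inj₁ _ ∷ _ = s≤s z≤n
    ... | false | inj₂ _ ∷ _ = s≤s z≤n
  ... | true  | .true  | inj₁ _ ∷ _ | inˡ h | _ = λ { ≡.refl → ℕ.≤-refl }
  ... | false | .false | inj₂ _ ∷ _ | inʳ h | _ = λ { ≡.refl → ℕ.≤-refl }

  last-split : ∀ (xs : List⁺ A) → ∃[ ys ] toList xs ≡ ys ∷ʳ last xs
  last-split xs with snocView xs
  ... | ys ∷ʳ′ y = ys , lemma ys y
    where
    lemma : ∀ ys y → toList (ys List⁺.∷ʳ y) ≡ ys ∷ʳ y
    lemma []      y = ≡.refl
    lemma (_ ∷ _) y = ≡.refl

  drop-suc : ∀ j {xs ys} {x : A} → drop j xs ≡ x ∷ ys → drop (suc j) xs ≡ ys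
  drop-suc zero    {x ∷ xs} ≡.refl = ≡.refl
  drop-suc (suc j) {x ∷ xs} eq   = drop-suc j {xs} eq

  AllPairs-++⁻ : ∀ {ℓ} {R : Rel A ℓ} xs {ys} → AllPairs R (xs ++ ys) →
                 AllPairs R xs × AllPairs R ys × All (λ x → All (R x) ys) xs
  AllPairs-++⁻ []       ps       = [] , ps , []
  AllPairs-++⁻ (x ∷ xs) (p ∷ ps) =
    let l , r , lr = AllPairs-++⁻ xs ps
    in All.++⁻ˡ xs p ∷ l , r , All.++⁻ʳ xs p ∷ lr

  AllPairs-reverse : ∀ {ℓ} {R : Rel A ℓ} {xs} → AllPairs R xs → AllPairs (flip R) (reverse xs)
  AllPairs-reverse {xs = []}     []       = []
  AllPairs-reverse {R = R} {xs = x ∷ xs} (p ∷ ps) = ≡.subst (AllPairs (flip R)) (≡.sym (List.unfold-reverse x xs))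
    (AllPairs.++⁺ (AllPairs-reverse ps) ([] ∷ [])
      (All.map (λ r → r ∷ []) (All.tabulate (λ y∈ → All.lookup p (Any.reverse⁻ y∈)))))

-- Sign runs of the coefficients and the bound `v`.

module Runs (ℝ : CompleteOrderedField) {n : ℕ} (a : Vector (CompleteOrderedField.Carrier ℝ) (suc n)) where
  open Real ℝ
  open Polynomial ℝ a
  open OrderedField ℝ
  open ExponentialSeries ℝ using (1≤^)

  ∣∣-nonneg : ∀ {x} → 0# ≤ x → ∣ x ∣ ≈ x
  ∣∣-nonneg {x} 0≤x with x <? 0#
  ... | yes x<0 = ⊥-elim (≤⇒≯ 0≤x x<0)
  ... | no  _   = refl

  ∣∣-neg : ∀ {x} → x < 0# → ∣ x ∣ ≈ - x
  ∣∣-neg {x} x<0 with x <? 0#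
  ... | yes _   = refl
  ... | no  x≮0 = ⊥-elim (x≮0 x<0)

  0<∣∣ : ∀ {x} → ¬ x ≈ 0# → 0# < ∣ x ∣
  0<∣∣ {x} x≉0 with ≤∨> 0# x
  ... | inj₂ x<0        = <-respʳ (sym (∣∣-neg x<0))
    (<-by (x<y⇒0<y-x x<0) (solve 1 (λ x → :- x :- con (+ 0) := con (+ 0) :- x) refl x))
  ... | inj₁ (inj₁ 0<x) = <-respʳ (sym (∣∣-nonneg (<⇒≤ 0<x))) 0<x
  ... | inj₁ (inj₂ 0≈x) = ⊥-elim (x≉0 (sym 0≈x))

  listSum : (Fin (suc n) → Carrier) → List (Fin (suc n)) → Carrier
  listSum f = List.foldr (λ i s → f i + s) 0#

  listSum-++ : ∀ f xs ys → listSum f (xs ++ ys) ≈ listSum f xs + listSum f ys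
  listSum-++ f []       ys = sym (+-identityˡ _)
  listSum-++ f (x ∷ xs) ys = trans (+-congˡ (listSum-++ f xs ys)) (sym (+-assoc _ _ _))

  listSum-reverse : ∀ f xs → listSum f (reverse xs) ≈ listSum f xs
  listSum-reverse f []       = refl
  listSum-reverse f (x ∷ xs) = trans (reflexive (≡.cong (listSum f) (List.unfold-reverse x xs)))
    (trans (listSum-++ f (reverse xs) [ x ]) (trans (+-cong (listSum-reverse f xs) (+-identityʳ _)) (+-comm _ _)))

  listSum-cong : ∀ {f g xs} → All (λ i → f i ≈ g i) xs → listSum f xs ≈ listSum g xs
  listSum-cong []       = refl
  listSum-cong (p ∷ ps) = +-cong p (listSum-cong ps)

  listSum-mono : ∀ {f g xs} → All (λ i → f i ≤ g i) xs → listSum f xs ≤ listSum g xs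
  listSum-mono []       = ≤-refl
  listSum-mono (p ∷ ps) = +-mono-≤ p (listSum-mono ps)

  listSum-0 : ∀ {f xs} → All (λ i → f i ≈ 0#) xs → listSum f xs ≈ 0#
  listSum-0 []       = refl
  listSum-0 (p ∷ ps) = trans (+-cong p (listSum-0 ps)) (+-identityˡ 0#)

  listSum-* : ∀ c f xs → listSum (λ i → c * f i) xs ≈ c * listSum f xs
  listSum-* c f []       = sym (zeroʳ c)
  listSum-* c f (x ∷ xs) = trans (+-congˡ (listSum-* c f xs)) (sym (distribˡ c _ _))

  listSum-filter : ∀ {p} {P : Fin (suc n) → Set p} (P? : ∀ i → Dec (P i)) f xs → (∀ i → ¬ P i → f i ≈ 0#) →
                   listSum f (filter P? xs) ≈ listSum f xs
  listSum-filter P? f []       f≈0 = refl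
  listSum-filter P? f (x ∷ xs) f≈0 with P? x
  ... | yes _  = +-congˡ (listSum-filter P? f xs f≈0)
  ... | no ¬px = trans (listSum-filter P? f xs f≈0) (trans (sym (+-identityˡ _)) (+-congʳ (sym (f≈0 x ¬px))))

  listSum-tabulate : ∀ {m} f (g : Fin m → Fin (suc n)) → sum (f ∘ g) ≈ listSum f (tabulate g)
  listSum-tabulate {zero}  f g = refl
  listSum-tabulate {suc m} f g = +-congˡ (listSum-tabulate f (g ∘ suc))

  sum-support : ∀ f → (∀ i → a i ≈ 0# → f i ≈ 0#) → sum f ≈ listSum f support
  sum-support f f≈0 = trans (listSum-tabulate f id) (trans (sym (listSum-reverse f (allFin (suc n))))
    (sym (listSum-filter (λ i → ¬? (a i ≟ 0#)) f (reverse (allFin (suc n))) vanish)))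
    where
    vanish : ∀ i → ¬ ¬ a i ≈ 0# → f i ≈ 0#
    vanish i ¬¬ai≈0 with a i ≟ 0#
    ... | yes ai≈0 = f≈0 i ai≈0
    ... | no  ai≉0 = ⊥-elim (¬¬ai≈0 ai≉0)

  _>ᶠ_ : Fin (suc n) → Fin (suc n) → Set
  i >ᶠ j = j Fin.< i

  support-sorted : AllPairs _>ᶠ_ support
  support-sorted = AllPairs.filter⁺ (λ i → ¬? (a i ≟ 0#)) (AllPairs-reverse (AllPairs.tabulate⁺-< id))

  support-nonzero : All (λ i → ¬ a i ≈ 0#) support
  support-nonzero = All.all-filter (λ i → ¬? (a i ≟ 0#)) (reverse (allFin (suc n)))

  ∈-support : ∀ i → ¬ a i ≈ 0# → i ∈ support
  ∈-support i ai≉0 = ∈-filter⁺ (λ i → ¬? (a i ≟ 0#)) (Any.reverse⁺ (∈-allFin i)) ai≉0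

  last-∈ : ∀ (r : List⁺ (Fin (suc n))) → last r ∈ toList r
  last-∈ r = let ys , eq = last-split r in ≡.subst (last r ∈_) (≡.sym eq) (∈-++⁺ʳ ys (here ≡.refl))

  run-within : ∀ r → AllPairs _>ᶠ_ (toList r) → All (Within r) (toList r)
  run-within r@(x ∷ xs) sorted@(x> ∷ _) = All.zip (≥last , ≤head)
    where
    ≤head : All (Fin._≤ x) (toList r)
    ≤head = ℕ.≤-refl ∷ All.map ℕ.<⇒≤ x>
    ≥last : All (last r Fin.≤_) (toList r)
    ≥last with last-split r
    ... | ys , eq = ≡.subst (All (last r Fin.≤_)) (≡.sym eq)
      (All.++⁺ (All.map (λ { (p ∷ []) → ℕ.<⇒≤ p })
        (proj₂ (proj₂ (AllPairs-++⁻ ys (≡.subst (AllPairs _>ᶠ_) eq sorted))))) (ℕ.≤-refl ∷ []))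

  ∣a∣ : Fin (suc n) → Carrier
  ∣a∣ i = ∣ a i ∣

  -- As `support` is strictly decreasing, entries before `r` exceed its largest index and entries
  -- after it lie below its smallest one. Hence the span of `r` meets the support in `r` alone, and
  -- zero coefficients add nothing.
  S-run : ∀ pre r post → pre ++ toList r ++ post ≡ support → S r ≈ listSum ∣a∣ (toList r)
  S-run pre r@(x ∷ xs) post eq = trans (sum-support f f≈0) (trans (reflexive (≡.cong (listSum f) (≡.sym eq)))
    (trans (listSum-++ f pre (toList r ++ post)) (trans (+-cong (listSum-0 pre≈0) (listSum-++ f (toList r) post))
      (trans (+-congˡ (+-cong (listSum-cong run≈) (listSum-0 post≈0)))
        (solve 1 (λ s → con (+ 0) :+ (s :+ con (+ 0)) := s) refl (listSum ∣a∣ (toList r)))))))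
    where
    within? : ∀ i → Dec (Within r i)
    within? i = (smallest r Fin.≤? i) ×-dec (i Fin.≤? largest r)
    f : Fin (suc n) → Carrier
    f i = if does (within? i) then ∣ a i ∣ else 0#
    f-inside : ∀ {i} → Within r i → f i ≈ ∣ a i ∣
    f-inside {i} w = reflexive (≡.cong (λ b → if b then ∣ a i ∣ else 0#) (dec-true (within? i) w))
    f-outside : ∀ {i} → ¬ Within r i → f i ≈ 0#
    f-outside {i} ¬w = reflexive (≡.cong (λ b → if b then ∣ a i ∣ else 0#) (dec-false (within? i) ¬w))
    f≈0 : ∀ i → a i ≈ 0# → f i ≈ 0#
    f≈0 i ai≈0 with does (within? i)
    ... | true  = trans (∣∣-nonneg (≤-reflexive (sym ai≈0))) ai≈0
    ... | false = refl
    split₁ = AllPairs-++⁻ pre (≡.subst (AllPairs _>ᶠ_) (≡.sym eq) support-sorted)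
    split₂ = AllPairs-++⁻ (toList r) (proj₁ (proj₂ split₁))
    run≈ : All (λ i → f i ≈ ∣a∣ i) (toList r)
    run≈ = All.map f-inside (run-within r (proj₁ split₂))
    pre≈0 : All (λ i → f i ≈ 0#) pre
    pre≈0 = All.map (λ { (x<i ∷ _) → f-outside (λ (_ , i≤x) → ℕ.<⇒≱ x<i i≤x) }) (proj₂ (proj₂ split₁))
    post≈0 : All (λ i → f i ≈ 0#) post
    post≈0 = All.map (λ i<last → f-outside (λ (last≤i , _) → ℕ.<⇒≱ i<last last≤i))
      (All.lookup (proj₂ (proj₂ split₂)) (last-∈ r))

  listSum-pos : ∀ {f} (r : List⁺ (Fin (suc n))) → All (λ i → 0# < f i) (toList r) → 0# < listSum f (toList r)
  listSum-pos (x ∷ xs) (p ∷ ps) = 0<+ p (≤-respˡ (listSum-0 {λ _ → 0#} (All.universal (λ _ → refl) xs))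
    (listSum-mono (All.map <⇒≤ ps)))

  signs-differ : ∀ {x y} → 0# < x → y < 0# → x * y < 0#
  signs-differ {x} {y} 0<x y<0 = <-respʳ (zeroʳ x) (*-monoˡ-< 0<x y<0)

  negative : ∀ {x} → ¬ x ≈ 0# → ¬ 0# < x → x < 0#
  negative {x} x≉0 x≯0 with ≮⇒≥ x≯0
  ... | inj₁ x<0 = x<0
  ... | inj₂ x≈0 = ⊥-elim (x≉0 x≈0)

  -- Only a sign change can open a new group. The bound guarantees that every complete pair of runs
  -- has an index below `k`, so that its local bound takes part in the maximum `v`.
  length-groups : ∀ xs → All (λ i → ¬ a i ≈ 0#) xs → length (groupSeqs (λ i → 0# <? a i) xs) ℕ.≤ suc
    (countChanges xs)
  length-groups []           _            = z≤n
  length-groups (i ∷ [])     _            = length-groupSeqs-change (λ i → 0# <? a i) i []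
  length-groups (i ∷ js@(j ∷ ks)) (i≉0 ∷ js≉0@(j≉0 ∷ _)) with length-groups js js≉0 | a i * a j <? 0#
  ... | ih | yes _ = ℕ.≤-trans (length-groupSeqs-change (λ i → 0# <? a i) i js) (s≤s ih)
  ... | ih | no ¬change = ℕ.≤-trans (length-groupSeqs-same (λ i → 0# <? a i) i j ks same) ih
    where
    same : does (0# <? a i) ≡ does (0# <? a j)
    same with 0# <? a i | 0# <? a j
    ... | yes _   | yes _   = ≡.refl
    ... | no _    | no _    = ≡.refl
    ... | yes 0<i | no j≯0  = ⊥-elim (¬change (signs-differ 0<i (negative j≉0 j≯0)))
    ... | no i≯0  | yes 0<j = ⊥-elim (¬change (<-respˡ (*-comm _ _) (signs-differ 0<j (negative i≉0 i≯0))))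

  module _ {v : Carrier} (bound : IsBound v) where
    private
      vs       = proj₁ bound
      isLocal  = proj₁ (proj₂ bound)
      isMax    = proj₂ (proj₂ bound)

    candidate≤v : ∀ j → j ℕ.< k → ∀ w → Candidate j w → w ≤ v
    candidate≤v j j<k w c = ≤-trans
      (proj₂ (isLocal (fromℕ< j<k)) w (≡.subst (λ j → Candidate j w) (≡.sym (Fin.toℕ-fromℕ< j<k)) c))
      (proj₂ isMax _ (_ , refl))

    1≤v : 1# ≤ v
    1≤v = candidate≤v 0 (≡.subst (0 ℕ.<_) (ℕ.+-comm 1 ⌊ signChanges /2⌋) (s≤s z≤n)) 1# (one refl)

  -- For `x > 1` the function `x - y ^ (m + 1)` is positive at `y = 1` and at most 0 at `y = x`,
  -- because `x ≤ x ^ (m + 1)`.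
  root-exists : ∀ {x} m → 1# ≤ x → ∃[ r ] IsRoot (suc m) x r
  root-exists {x} m 1≤x with ≤∨> x 1#
  ... | inj₁ x≤1 = 1# , 0≤1 , trans (1^ (suc m)) (≤-antisym 1≤x x≤1)
  ... | inj₂ 1<x = r , ≤-trans 0≤1 1≤r , trans (solve 2 (λ x p → p := x :- (x :- p)) refl x (r ^ suc m))
      (trans (+-congˡ (-‿cong x-r^m≈0)) (solve 1 (λ x → x :- con (+ 0) := x) refl x))
    where
    lipschitz = ^-lipschitz (suc m) (≤-trans 0≤1 1≤x)
    difference : ∀ p q → q - p ≈ (x - p) - (x - q)
    difference = solve 3 (λ x p q → q :- p := (x :- p) :- (x :- q)) refl x
    bounded : ∀ {y y′} → 1# ≤ y → y′ ≤ x → y ≤ y′ →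
              Bounded ((x - y ^ suc m) - (x - y′ ^ suc m)) (proj₁ lipschitz * (y′ - y))
    bounded {y} {y′} 1≤y y′≤x y≤y′ = nonneg⇒bounded
      (≤-respʳ (difference (y ^ suc m) (y′ ^ suc m)) (x≤y⇒0≤y-x (^-mono-≤ (suc m) (≤-trans 0≤1 1≤y) y≤y′)))
      (≤-respˡ (difference (y ^ suc m) (y′ ^ suc m)) (proj₂ (proj₂ lipschitz) (≤-trans 0≤1 1≤y) y≤y′ y′≤x))
    x≤x^m : x ≤ x ^ suc m
    x≤x^m = ≤-respˡ (*-identityʳ x) (*-monoˡ-≤ (≤-trans 0≤1 1≤x) (1≤^ m 1≤x))
    zero-of : ∃[ r ] ∃[ 1≤r ] ∃[ r≤x ] (x - r ^ suc m ≈ 0#)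
    zero-of = intermediate-value {1#} {x} (λ y _ _ → x - y ^ suc m) (proj₁ (proj₂ lipschitz))
      (λ 1≤y _ _ y′≤x y≤y′ → bounded 1≤y y′≤x y≤y′) 1≤x
      (<-respʳ (+-congˡ (-‿cong (sym (1^ (suc m))))) (x<y⇒0<y-x 1<x))
      (≤-respʳ (-‿inverseʳ x) (+-mono-≤ ≤-refl (neg-mono-≤ x≤x^m)))
    r = proj₁ zero-of
    1≤r = proj₁ (proj₂ zero-of)
    x-r^m≈0 = proj₂ (proj₂ (proj₂ zero-of))

  Dominated : Carrier → List⁺ (Fin (suc n)) → List⁺ (Fin (suc n)) → Set
  Dominated v pos neg = ∀ i → Within neg i → S neg ≤ S pos * v ^ (toℕ (smallest pos) ℕ.∸ toℕ i)

  -- If the inequality failed, the ratio `S neg / S pos` would exceed `v ^ m`, hence be at least 1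
  -- and possess an `m`-th root. That root is a candidate, so it is at most `v`, and its `m`-th
  -- power is at most `v ^ m`. Arguing by contradiction thus confines the need for roots to ratios
  -- at least 1.
  dominated : ∀ {v j pos neg} → IsBound v → j ℕ.< k → positiveRun j ≡ just pos → negativeRun j ≡ just neg →
    0# < S pos →
              largest neg Fin.< smallest pos → Dominated v pos neg
  dominated {v} {j} {pos} {neg} bound j<k pos-eq neg-eq 0<S neg<pos i i∈neg with ≤∨> (S neg)
    (S pos * v ^ (toℕ (smallest pos) ℕ.∸ toℕ i))
  ... | inj₁ S≤ = S≤
  ... | inj₂ S> = ⊥-elim (≤⇒≯ S/S≤v^m v^m<S/S)
    where
    m = toℕ (smallest pos) ℕ.∸ toℕ i
    v^m<S/S : v ^ m < S neg / S pos
    v^m<S/S = *-cancelˡ-< 0<S (<-respʳ (sym (*/-cancel 0<S)) S>)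
    1≤S/S : 1# ≤ S neg / S pos
    1≤S/S = ≤-trans (1≤^ m (1≤v bound)) (<⇒≤ v^m<S/S)
    m-pos : m ≡ suc (ℕ.pred m)
    m-pos = ≡.sym (ℕ.suc-pred m {{ℕ.>-nonZero (ℕ.m<n⇒0<n∸m (ℕ.≤-<-trans (proj₂ i∈neg) neg<pos))}})
    the-root : ∃[ r ] IsRoot m (S neg / S pos) r
    the-root = ≡.subst (λ m → ∃[ r ] IsRoot m (S neg / S pos) r) (≡.sym m-pos) (root-exists (ℕ.pred m) 1≤S/S)
    S/S≤v^m : S neg / S pos ≤ v ^ m
    S/S≤v^m = let r , 0≤r , r^m≈ = the-root in
      ≤-respˡ r^m≈ (^-mono-≤ m 0≤r (candidate≤v bound j j<k r (root pos-eq neg-eq i i∈neg (0≤r , r^m≈))))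

  -- Pairing the runs against growing weights.

  module _ {v : Carrier} (bound : IsBound v) (u : ℕ → Carrier)
    (0≤u : ∀ i → i ℕ.≤ n → 0# ≤ u i) (u-grow : ∀ i → i ℕ.< n → v * u i ≤ u (suc i)) where

    private
      0≤v : 0# ≤ v
      0≤v = ≤-trans 0≤1 (1≤v bound)

      weight : Fin (suc n) → Carrier
      weight i = u (toℕ i)

      summand : Fin (suc n) → Carrier
      summand i = a i * weight i

    u-power : ∀ m i → m ℕ.+ i ℕ.≤ n → v ^ m * u i ≤ u (m ℕ.+ i)
    u-power zero    i _     = ≤-reflexive (*-identityˡ _)
    u-power (suc m) i m+i<n = ≤-trans
      (≤-respˡ (sym (*-assoc _ _ _)) (*-monoˡ-≤ 0≤v (u-power m i (ℕ.<⇒≤ m+i<n)))) (u-grow (m ℕ.+ i) m+i<n)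

    u-power-≤ : ∀ {i j} → i ℕ.≤ j → j ℕ.≤ n → v ^ (j ℕ.∸ i) * u i ≤ u j
    u-power-≤ {i} {j} i≤j j≤n = ≡.subst (λ m → v ^ (j ℕ.∸ i) * u i ≤ u m) (ℕ.m∸n+n≡m i≤j)
      (u-power (j ℕ.∸ i) i (≡.subst (ℕ._≤ n) (≡.sym (ℕ.m∸n+n≡m i≤j)) j≤n))

    u-mono : ∀ {i j} → i ℕ.≤ j → j ℕ.≤ n → u i ≤ u j
    u-mono {i} {j} i≤j j≤n = ≤-trans
      (≤-respˡ (*-identityˡ _) (*-monoʳ-≤ (0≤u i (ℕ.≤-trans i≤j j≤n)) (1≤^ (j ℕ.∸ i) (1≤v bound))))
        (u-power-≤ i≤j j≤n)

    positive-sum : ∀ xs → All (λ i → 0# < a i) xs → 0# ≤ listSum summand xs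
    positive-sum []       []       = ≤-refl
    positive-sum (i ∷ xs) (p ∷ ps) = 0≤+ (0≤* (<⇒≤ p) (0≤u (toℕ i) (Fin.toℕ≤pred[n] i))) (positive-sum xs ps)

    -- For each `i` in the negative run, `S neg * u i ≤ S pos * v ^ (p - i) * u i ≤ S pos * u
    -- p`. Multiplying by `∣ a i ∣` and summing over the run makes `S neg` a factor of both sides,
    -- and cancelling it bounds the negative run by `S pos * u p`.
    pair-sum : ∀ pos neg → Dominated v pos neg → largest neg Fin.< smallest pos →
               AllPairs _>ᶠ_ (toList pos) → AllPairs _>ᶠ_ (toList neg) →
               All (λ i → 0# < a i) (toList pos) → All (λ i → a i < 0#) (toList neg) →
               S pos ≈ listSum ∣a∣ (toList pos) → S neg ≈ listSum ∣a∣ (toList neg) →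
               0# ≤ listSum summand (toList pos) + listSum summand (toList neg)
    pair-sum pos neg dom neg<pos pos> neg> 0<a a<0 S-pos S-neg =
      ≤-by (0≤+ (x≤y⇒0≤y-x lower) (x≤y⇒0≤y-x upper))
        (trans (+-congˡ (solve 0 (:- con (+ 0) := con (+ 0)) refl)) (trans (+-congʳ (+-congˡ neg-abs))
          (solve 3 (λ p q s → p :+ :- q :+ con (+ 0) := p :- s :+ (s :- q)) refl (listSum summand (toList pos))
            (listSum (λ i → ∣ a i ∣ * weight i) (toList neg)) (S pos * uₚ))))
      where
      p = smallest pos
      uₚ = weight p
      p≤n = Fin.toℕ≤pred[n] p
      lower : S pos * uₚ ≤ listSum summand (toList pos)
      lower = ≤-respˡ (trans (listSum-* uₚ ∣a∣ (toList pos)) (trans (*-comm _ _) (*-congʳ (sym S-pos))))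
        (listSum-mono (All.zipWith (λ { {i} ((p≤i , _) , 0<ai) → ≤-respˡ (*-comm _ _)
          (*-mono-≤ (≤-respʳ (sym (∣∣-nonneg (<⇒≤ 0<ai))) (<⇒≤ 0<ai)) (0≤u (toℕ i) (Fin.toℕ≤pred[n] i))
            (≤-reflexive (∣∣-nonneg (<⇒≤ 0<ai))) (u-mono p≤i (Fin.toℕ≤pred[n] i))) }) (run-within pos pos> , 0<a)))
      0<S-neg : 0# < S neg
      0<S-neg = <-respʳ (sym S-neg) (listSum-pos neg (All.map (λ ai<0 → 0<∣∣ (λ ai≈0 → <-irrefl ai≈0 ai<0)) a<0))
      upper : listSum (λ i → ∣ a i ∣ * weight i) (toList neg) ≤ S pos * uₚ
      upper = *-cancelˡ-≤ 0<S-neg (≤-respˡ (listSum-* (S neg) (λ i → ∣ a i ∣ * weight i) (toList neg))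
        (≤-respʳ (trans (listSum-* (S pos * uₚ) ∣a∣ (toList neg)) (trans (*-comm _ _) (*-congʳ (sym S-neg))))
          (listSum-mono (All.zipWith (λ { {i} (within , ai<0) → termwise i within ai<0 })
            (run-within neg neg> , a<0)))))
        where
        termwise : ∀ i → Within neg i → a i < 0# → S neg * (∣ a i ∣ * weight i) ≤ S pos * uₚ * ∣ a i ∣
        termwise i within ai<0 = ≤-respˡ (solve 3 (λ s x u → x :* (s :* u) := s :* (x :* u)) refl
          (S neg) ∣ a i ∣ (weight i))
          (≤-respʳ (*-comm _ _) (*-monoˡ-≤ (<⇒≤ (0<∣∣ (λ ai≈0 → <-irrefl ai≈0 ai<0)))
            (≤-trans (*-monoʳ-≤ (0≤u (toℕ i) (Fin.toℕ≤pred[n] i)) (dom i within))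
              (≤-respˡ (sym (*-assoc _ _ _))
                (*-monoˡ-≤ (≤-respʳ (sym S-pos) (<⇒≤ (listSum-pos pos (All.map (λ 0<ai → 0<∣∣ (0<⇒≉0 0<ai)) 0<a))))
                (u-power-≤ (ℕ.<⇒≤ (ℕ.≤-<-trans (proj₂ within) neg<pos)) p≤n))))))
      neg-abs : listSum summand (toList neg) ≈ - listSum (λ i → ∣ a i ∣ * weight i) (toList neg)
      neg-abs = trans (listSum-cong
        (All.map (λ {i} ai<0 → trans (solve 2 (λ x u → x :* u := con (-[1+ 0 ]) :* (:- x :* u)) refl (a i)
        (weight i))
          (*-congˡ (*-congʳ (sym (∣∣-neg ai<0))))) a<0))
        (trans (listSum-* (- 1#) (λ i → ∣ a i ∣ * weight i) (toList neg))
          (solve 1 (λ s → con (-[1+ 0 ]) :* s := :- s) refl _))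

    Signed : List⁺ (Fin (suc n)) ⊎ List⁺ (Fin (suc n)) → Set
    Signed = Sum.All (All⁺ (λ i → 0# < a i)) (All⁺ (λ i → ¬ 0# < a i))

    -- Here `j` pairs of runs, making up `pre`, have been consumed. The `drop` equations identify
    -- the next groups with the runs of index `j`, and the bound on the length yields `j < k` as
    -- soon as a complete pair remains. A final unpaired group is positive and needs no bound.
    groups-sum : ∀ j pre gs → Alternating true gs → All Signed gs → pre ++ ungroupSeqs gs ≡ support →
                 drop j positiveRuns ≡ proj₁ (partitionSums gs) → drop j negativeRuns ≡ proj₂ (partitionSums gs) →
                 j ℕ.+ j ℕ.+ length gs ℕ.≤ suc signChanges → 0# ≤ listSum summand (ungroupSeqs gs)
    groups-sum j pre [] _ _ _ _ _ _ = ≤-refl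
    groups-sum j pre (inj₁ p ∷ []) _ (Sum.inj₁ pos ∷ []) _ _ _ _ =
      positive-sum (toList p ++ []) (All.++⁺ (toList⁺ pos) [])
    groups-sum j pre (inj₁ p ∷ inj₂ q ∷ gs) (inˡ inʳ alt)
      (Sum.inj₁ pos ∷ Sum.inj₂ nonpos ∷ signed) eq pos-eq neg-eq j≤ =
      ≤-respʳ (trans (+-assoc _ _ _) (trans (+-congˡ (sym (listSum-++ summand (toList q) rest)))
        (sym (listSum-++ summand (toList p) (toList q ++ rest)))))
        (0≤+ (pair-sum p q (dominated bound j<k (≡.cong head pos-eq)
          (≡.cong head neg-eq) 0<S q<p) q<p p> q> 0<a a<0 S-p S-q)
             (groups-sum (suc j) (pre ++ toList p ++ toList q) gs alt signed eq₂ (drop-suc j pos-eq)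
               (drop-suc j neg-eq)
               (ℕ.≤-trans (ℕ.≤-reflexive count) j≤)))
      where
      rest = ungroupSeqs gs
      count : suc j ℕ.+ suc j ℕ.+ length gs ≡ j ℕ.+ j ℕ.+ suc (suc (length gs))
      count = ≡.trans (≡.cong (λ x → suc x ℕ.+ length gs) (ℕ.+-suc j j))
        (≡.sym (≡.trans (ℕ.+-suc (j ℕ.+ j) (suc (length gs))) (≡.cong suc (ℕ.+-suc (j ℕ.+ j) (length gs)))))
      eq₁ : (pre ++ toList p) ++ toList q ++ rest ≡ support
      eq₁ = ≡.trans (List.++-assoc pre (toList p) (toList q ++ rest)) eq
      eq₂ : (pre ++ toList p ++ toList q) ++ rest ≡ support
      eq₂ = ≡.trans (List.++-assoc pre (toList p ++ toList q) rest)
        (≡.trans (≡.cong (pre ++_) (List.++-assoc (toList p) (toList q) rest)) eq)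
      2j+1≤s : suc (j ℕ.+ j) ℕ.≤ signChanges
      2j+1≤s = ℕ.≤-trans (s≤s (ℕ.m≤m+n (j ℕ.+ j) (length gs)))
        (ℕ.s≤s⁻¹ (ℕ.≤-trans (ℕ.≤-reflexive
        (≡.sym (≡.trans (ℕ.+-suc (j ℕ.+ j) (suc (length gs))) (≡.cong suc (ℕ.+-suc (j ℕ.+ j) (length gs)))))) j≤))
      j<k : j ℕ.< k
      j<k = ≡.subst (suc j ℕ.≤_) (ℕ.+-comm 1 ⌊ signChanges /2⌋)
        (s≤s (ℕ.≤-trans (ℕ.≤-reflexive (ℕ.n≡⌊n+n/2⌋ j)) (ℕ.⌊n/2⌋-mono (ℕ.<⇒≤ 2j+1≤s))))
      sorted = proj₁ (proj₂ (AllPairs-++⁻ pre (≡.subst (AllPairs _>ᶠ_) (≡.sym eq) support-sorted)))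
      p> = proj₁ (AllPairs-++⁻ (toList p) sorted)
      q> = proj₁ (AllPairs-++⁻ (toList q) (proj₁ (proj₂ (AllPairs-++⁻ (toList p) sorted))))
      q<p : largest q Fin.< smallest p
      q<p = All.head (All.lookup (proj₂ (proj₂ (AllPairs-++⁻ (toList p) sorted))) (last-∈ p))
      nonzero : All (λ i → ¬ a i ≈ 0#) (toList q)
      nonzero = All.++⁻ˡ (toList q)
        (All.++⁻ʳ (pre ++ toList p) (≡.subst (All (λ i → ¬ a i ≈ 0#)) (≡.sym eq₁) support-nonzero))
      0<a : All (λ i → 0# < a i) (toList p)
      0<a = toList⁺ pos
      a<0 : All (λ i → a i < 0#) (toList q)
      a<0 = All.zipWith (λ (a≉0 , a≯0) → negative a≉0 a≯0) (nonzero , toList⁺ nonpos)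
      S-p : S p ≈ listSum ∣a∣ (toList p)
      S-p = S-run pre p (toList q ++ rest) eq
      S-q : S q ≈ listSum ∣a∣ (toList q)
      S-q = S-run (pre ++ toList p) q rest eq₁
      0<S : 0# < S p
      0<S = <-respʳ (sym S-p) (listSum-pos p (All.map (λ 0<ai → 0<∣∣ (0<⇒≉0 0<ai)) 0<a))

    weighted-sum-nonneg : 0# < a (fromℕ n) → 0# ≤ sum summand
    weighted-sum-nonneg 0<aₙ = ≤-respʳ (sym (sum-support summand (λ i ai≈0 → trans (*-congʳ ai≈0) (zeroˡ _))))
      (≡.subst (λ xs → 0# ≤ listSum summand xs) (List⁺.ungroupSeqs-groupSeqs (λ i → 0# <? a i) support)
        (groups-sum 0 [] (groupSeqs (λ i → 0# <? a i) support) alternating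
          (List⁺.groupSeqs-groups (λ i → 0# <? a i) support)
          (List⁺.ungroupSeqs-groupSeqs (λ i → 0# <? a i) support) ≡.refl ≡.refl
            (length-groups support support-nonzero)))
      where
      starts-positive : ∀ xs → fromℕ n ∈ xs → AllPairs _>ᶠ_ xs → Alternating true (groupSeqs (λ i → 0# <? a i) xs)
      starts-positive (x ∷ xs) (here ≡.refl) _ = ≡.subst
        (λ b → Alternating b (groupSeqs (λ i → 0# <? a i) (x ∷ xs)))
        (dec-true (0# <? a x) 0<aₙ) (groupSeqs-alternating (λ i → 0# <? a i) x xs)
      starts-positive (x ∷ xs) (there n∈xs) (x> ∷ _) = ⊥-elim
        (ℕ.<⇒≱ (All.lookup x> n∈xs) (≡.subst (toℕ x ℕ.≤_) (≡.sym (Fin.toℕ-fromℕ n)) (Fin.toℕ≤pred[n] x)))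
      alternating = starts-positive support (∈-support (fromℕ n) (0<⇒≉0 0<aₙ)) support-sorted

-- From the sector to positive weights, and the conclusion.

module Sectors (ℝ : CompleteOrderedField) where
  open Real ℝ hiding (zero)
  open Complex ℝ
  open OrderedField ℝ
  open ExponentialSeries ℝ
  open SemiringSum semiring using (sum-cong-≋)

  sum-diff : ∀ {m} (f g : Vector Carrier m) → sum f - sum g ≈ sum (λ i → f i - g i)
  sum-diff {zero}  f g = -‿inverseʳ 0#
  sum-diff {suc m} f g = trans (solve 4 (λ x s y t → x :+ s :- (y :+ t) := x :- y :+ (s :- t)) refl (f zero)
    (sum (f ∘ suc)) (g zero) (sum (g ∘ suc)))
    (+-congˡ (sum-diff (f ∘ suc) (g ∘ suc)))

  sum-nonneg : ∀ {m} {f : Vector Carrier m} → (∀ i → 0# ≤ f i) → 0# ≤ sum f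
  sum-nonneg {zero}  0≤f = ≤-refl
  sum-nonneg {suc m} 0≤f = 0≤+ (0≤f zero) (sum-nonneg (0≤f ∘ suc))

  sum-pos : ∀ {m} {f : Vector Carrier m} → (∀ i → 0# ≤ f i) → ∀ i → 0# < f i → 0# < sum f
  sum-pos 0≤f zero    0<f = 0<+ 0<f (sum-nonneg (0≤f ∘ suc))
  sum-pos 0≤f (suc i) 0<f = <-respʳ (+-comm _ _) (0<+ (sum-pos (0≤f ∘ suc) i 0<f) (0≤f zero))

  -- Lowering the last weight to v times its predecessor keeps the weak growth
  -- condition and decreases the weighted sum by a positive amount.
  weighted-sum-pos : ∀ {n} (a : Vector Carrier (suc n)) {v} → Polynomial.IsBound ℝ a v → 1 ℕ.≤ n → 0# < a
    (fromℕ n) →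
    (u : ℕ → Carrier) → (∀ i → i ℕ.≤ n → 0# ≤ u i) → (∀ i → i ℕ.< n → v * u i < u (suc i)) →
    0# < sum (λ i → a i * u (toℕ i))
  weighted-sum-pos {suc n} a {v} bound _ 0<aₙ u 0≤u u-grow = <-respʳ
    (trans (+-congˡ (sym (sum-diff (λ i → a i * u (toℕ i)) (λ i → a i * u′ (toℕ i)))))
      (solve 2 (λ s t → t :+ (s :- t) := s) refl (sum (λ i → a i * u (toℕ i))) (sum (λ i → a i * u′ (toℕ i)))))
    (<-respʳ (+-comm _ _) (0<+ (sum-pos excess-nonneg (fromℕ (suc n)) excess-pos)
      (Runs.weighted-sum-nonneg ℝ a bound u′ 0≤u′ u′-grow 0<aₙ)))
    where
    0≤v = ≤-trans 0≤1 (Runs.1≤v ℝ a bound)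
    u′ : ℕ → Carrier
    u′ i = if does (i ℕ.<? suc n) then u i else v * u n
    u′-below : ∀ {i} → i ℕ.< suc n → u′ i ≈ u i
    u′-below {i} i<n = reflexive (≡.cong (λ b → if b then u i else v * u n) (dec-true (i ℕ.<? suc n) i<n))
    u′-top : u′ (suc n) ≈ v * u n
    u′-top = reflexive (≡.cong (λ b → if b then u (suc n) else v * u n)
      (dec-false (suc n ℕ.<? suc n) (ℕ.n≮n (suc n))))
    0≤u′ : ∀ i → i ℕ.≤ suc n → 0# ≤ u′ i
    0≤u′ i i≤n with ℕ.m≤n⇒m<n∨m≡n i≤n
    ... | inj₁ i<n     = ≤-respʳ (sym (u′-below i<n)) (0≤u i i≤n)
    ... | inj₂ ≡.refl = ≤-respʳ (sym u′-top) (0≤* 0≤v (0≤u n (ℕ.n≤1+n n)))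
    u′-grow : ∀ i → i ℕ.< suc n → v * u′ i ≤ u′ (suc i)
    u′-grow i i<n with ℕ.m≤n⇒m<n∨m≡n i<n
    ... | inj₁ 1+i<n  = ≤-respˡ (*-congˡ (sym (u′-below i<n))) (≤-respʳ (sym (u′-below 1+i<n)) (<⇒≤ (u-grow i i<n)))
    ... | inj₂ ≡.refl = ≤-reflexive (trans (*-congˡ (u′-below i<n)) (sym u′-top))
    excess-pos : 0# < a (fromℕ (suc n)) * u (toℕ (fromℕ (suc n))) - a (fromℕ (suc n)) * u′ (toℕ (fromℕ (suc n)))
    excess-pos = ≡.subst (λ i → 0# < a (fromℕ (suc n)) * u i - a (fromℕ (suc n)) * u′ i)
      (≡.sym (Fin.toℕ-fromℕ (suc n)))
      (x<y⇒0<y-x (*-monoˡ-< 0<aₙ (<-respˡ (sym u′-top) (u-grow n ℕ.≤-refl))))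
    excess-nonneg : ∀ i → 0# ≤ a i * u (toℕ i) - a i * u′ (toℕ i)
    excess-nonneg i with ℕ.m≤n⇒m<n∨m≡n (Fin.toℕ≤pred[n] i)
    ... | inj₁ i<n = ≤-reflexive (sym (trans (+-congˡ (-‿cong (*-congˡ (u′-below i<n)))) (-‿inverseʳ _)))
    ... | inj₂ i≡n = ≡.subst (λ i → 0# ≤ a i * u (toℕ i) - a i * u′ (toℕ i))
      (Fin.toℕ-injective (≡.trans (Fin.toℕ-fromℕ (suc n)) (≡.sym i≡n))) (<⇒≤ excess-pos)

  im-sum : ∀ {m} g (f : Vector ℂ m) → im (g *ℂ sumℂ f) ≈ sum (λ i → im (g *ℂ f i))
  im-sum {zero}  g f = proj₂ (ℂᴿ.zeroʳ g)
  im-sum {suc m} g f = trans (proj₂ (ℂᴿ.distribˡ g (f zero) (sumℂ (f ∘ suc)))) (+-congˡ (im-sum g (f ∘ suc)))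

  im-scale : ∀ x z → im (ofReal x *ℂ z) ≈ x * im z
  im-scale x (c +i d) = solve 3 (λ x c d → x :* d :+ con (+ 0) :* c := x :* d) refl x c d

  module _ {n v ρ g e z} (0≤v : 0# ≤ v) (0<ρ : 0# < ρ) (z≈ : z ≈ℂ ofReal v +ℂ ofReal ρ *ℂ e)
           (g-pos : ∀ m → m ℕ.≤ n → 0# < im (g *ℂ (e ^ℂ m))) where
    private
      w : ℂ
      w = ofReal ρ *ℂ e

    w^ : ∀ c → w ^ℂ c ≈ℂ ofReal (ρ ^ c) *ℂ (e ^ℂ c)
    w^ zero    = ℂᴿ.sym (ℂᴿ.*-identityˡ 1ℂ)
    w^ (suc c) = ℂᴿ.trans (ℂᴿ.*-congˡ {w} (w^ c)) (ℂᴿ.trans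
      (solveℂ 4 (λ r e p q → r ⊗ e ⊗ (p ⊗ q) ⊜ r ⊗ p ⊗ (e ⊗ q)) ℂᴿ.refl (ofReal ρ) e (ofReal (ρ ^ c)) (e ^ℂ c))
      (ℂᴿ.*-congʳ {e *ℂ (e ^ℂ c)} (ofReal-* ρ (ρ ^ c))))

    step : ∀ c b → im (g *ℂ ((w ^ℂ c) *ℂ (z ^ℂ suc b))) ≈ v * im (g *ℂ ((w ^ℂ c) *ℂ (z ^ℂ b))) + im
      (g *ℂ ((w ^ℂ suc c) *ℂ (z ^ℂ b)))
    step c b = trans
      (proj₂ (ℂᴿ.trans (ℂᴿ.*-congˡ {g} (ℂᴿ.*-congˡ {w ^ℂ c} (ℂᴿ.*-congʳ {z ^ℂ b} z≈)))
        (solveℂ 5 (λ g p v w q → g ⊗ (p ⊗ ((v ⊕ w) ⊗ q)) ⊜ v ⊗ (g ⊗ (p ⊗ q)) ⊕ g ⊗ (w ⊗ p ⊗ q)) ℂᴿ.refl g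
          (w ^ℂ c) (ofReal v) w (z ^ℂ b))))
      (+-congʳ (im-scale v (g *ℂ ((w ^ℂ c) *ℂ (z ^ℂ b)))))

    upper-half-plane : ∀ c b → c ℕ.+ b ℕ.≤ n → 0# < im (g *ℂ ((w ^ℂ c) *ℂ (z ^ℂ b)))
    upper-half-plane c zero c≤n = <-respʳ (sym (trans
      (proj₂ (ℂᴿ.trans (ℂᴿ.*-congˡ {g} (ℂᴿ.trans (ℂᴿ.*-identityʳ (w ^ℂ c)) (w^ c)))
        (solveℂ 3 (λ g p q → g ⊗ (p ⊗ q) ⊜ p ⊗ (g ⊗ q)) ℂᴿ.refl g (ofReal (ρ ^ c)) (e ^ℂ c))))
      (im-scale (ρ ^ c) (g *ℂ (e ^ℂ c)))))
      (*-pos (^-pos c 0<ρ) (g-pos c (≡.subst (ℕ._≤ n) (ℕ.+-identityʳ c) c≤n)))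
    upper-half-plane c (suc b) c+b<n = <-respʳ (sym (trans (step c b) (+-comm _ _)))
      (0<+ (upper-half-plane (suc c) b c+b<n′) (0≤* 0≤v (<⇒≤ (upper-half-plane c b (ℕ.<⇒≤ c+b<n′)))))
      where
      c+b<n′ : suc (c ℕ.+ b) ℕ.≤ n
      c+b<n′ = ≡.subst (ℕ._≤ n) (ℕ.+-suc c b) c+b<n

    private
      u : ℕ → Carrier
      u i = im (g *ℂ (z ^ℂ i))
      u≈ : ∀ i → im (g *ℂ ((w ^ℂ 0) *ℂ (z ^ℂ i))) ≈ u i
      u≈ i = proj₂ (ℂᴿ.*-congˡ {g} (ℂᴿ.*-identityˡ (z ^ℂ i)))

    powers-grow : ∀ i → i ℕ.< n → v * u i < u (suc i)
    powers-grow i i<n = <-by (upper-half-plane 1 i i<n)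
      (trans (+-congʳ (trans (sym (u≈ (suc i))) (trans (step 0 i) (+-congʳ (*-congˡ (u≈ i))))))
        (solve 2 (λ p q → p :+ q :- p := q) refl (v * u i) (im (g *ℂ ((w ^ℂ 1) *ℂ (z ^ℂ i))))))

    not-zero : (a : Vector Carrier (suc n)) → Polynomial.IsBound ℝ a v → 1 ℕ.≤ n → 0# < a (fromℕ n) →
               ¬ (Polynomial.eval ℝ a z ≈ℂ 0ℂ)
    not-zero a bound 1≤n 0<aₙ eval≈0 = <-irrefl refl
      (<-respʳ (trans (sum-cong-≋ summand) (trans (sym (im-sum g (λ i → ofReal (a i) *ℂ (z ^ℂ toℕ i))))
        (trans (proj₂ (ℂᴿ.*-congˡ {g} eval≈0)) (proj₂ (ℂᴿ.zeroʳ g)))))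
      (weighted-sum-pos a bound 1≤n 0<aₙ u (λ i i≤n → <⇒≤ (<-respʳ (u≈ i) (upper-half-plane 0 i i≤n))) powers-grow))
      where
      summand : ∀ i → a i * u (toℕ i) ≈ im (g *ℂ (ofReal (a i) *ℂ (z ^ℂ toℕ i)))
      summand i = sym (trans (proj₂ (solveℂ 3 (λ g p q → g ⊗ (p ⊗ q) ⊜ p ⊗ (g ⊗ q)) ℂᴿ.refl g (ofReal (a i))
        (z ^ℂ toℕ i))) (im-scale (a i) (g *ℂ (z ^ℂ toℕ i))))

  ∣∣<⇒bounds : ∀ {x r} → ∣ x ∣ < r → - r < x × x < r
  ∣∣<⇒bounds {x} {r} ∣x∣<r with x <? 0#
  ... | yes x<0 = <-respʳ (solve 1 (λ x → :- :- x := x) refl x) (neg-mono-< ∣x∣<r) ,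
                  <-trans (<-trans x<0 (<-by (x<y⇒0<y-x x<0)
                    (solve 1 (λ x → :- x :- con (+ 0) := con (+ 0) :- x) refl x))) ∣x∣<r
  ... | no x≮0  = <-≤-trans (<-by (≤-<-trans (≮⇒≥ x≮0) ∣x∣<r) (solve 1 (λ r → con (+ 0) :- :- r := r) refl r))
    (≮⇒≥ x≮0) , ∣x∣<r

  sector-free : (n : ℕ) → 1 ℕ.≤ n → (a : Vector Carrier (suc n)) → 0# < a (fromℕ n) →
    (v : Carrier) → Polynomial.IsBound ℝ a v → (π : Carrier) → IsPi π →
    (z : ℂ) → Sector v (π / fromNat n) z → ¬ (Polynomial.eval ℝ a z ≈ℂ 0ℂ)
  sector-free (suc n) 1≤n a 0<aₙ v bound π (0<π , (eπ , π-cis , _) , sin≉0) z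
    (ρ , φ , e , 0<ρ , ∣φ∣<θ , φ-cis , z≈) eval≈0 =
    -- The goal is empty, so the double negation may be stripped. A number `q > 1 / π` gives
    -- `1 ≤ q π`, which is what converts the convergence of the series at `π` into the full
    -- Archimedean property.
    ¬¬archimedean (1# / π) λ { (q , 1/π<q) →
      let 1≤qπ = ≤-respˡ (*/-cancel 0<π) (≤-respʳ (*-comm _ _) (*-monoˡ-≤ (<⇒≤ 0<π) (<⇒≤ 1/π<q)))
          archimedean = archimedean-from-cis {π} {eπ} q 0<π 1≤qπ π-cis
          N , N-large = archimedean (π + π + (π + π))
          -- The index `N` lies beyond `4 π`, where the terms for `2 π` begin to halve; adding 2
          -- secures `2 ≤ N₀`.
          g , g-pos = Cis.rotation ℝ archimedean π 0<π (2 ℕ.+ N) (ℕ.m≤m+n 2 N)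
            (≤-trans (<⇒≤ N-large) (fromNat-mono-≤ (ℕ.m≤n+m N 2)))
            sin≉0 (suc n) {φ} {e} φ≤π -π<nφ nφ<π φ-cis
      in not-zero {suc n} {v} {ρ} {g} {e} {z}
        (≤-trans 0≤1 (Runs.1≤v ℝ a bound)) 0<ρ z≈ g-pos a bound 1≤n 0<aₙ eval≈0 }
    where
    θ = π / fromNat (suc n)
    nθ≈π : fromNat (suc n) * θ ≈ π
    nθ≈π = */-cancel (fromNat-pos n)
    0<θ : 0# < θ
    0<θ = 0</ 0<π (fromNat-pos n)
    θ≤π : θ ≤ π
    θ≤π = ≤-respʳ nθ≈π (≤-by (0≤* (fromNat-nonneg n) (<⇒≤ 0<θ))
      (solve 2 (λ m θ → (con (+ 1) :+ m) :* θ :- θ := m :* θ) refl (fromNat n) θ))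
    φ-bounds = ∣∣<⇒bounds {φ} ∣φ∣<θ
    φ≤π : Bounded φ π
    φ≤π = bounded-weaken θ≤π (<⇒≤ (proj₁ φ-bounds) , <⇒≤ (proj₂ φ-bounds))
    nφ<π : fromNat (suc n) * φ < π
    nφ<π = <-respʳ nθ≈π (*-monoˡ-< (fromNat-pos n) (proj₂ φ-bounds))
    -π<nφ : - π < fromNat (suc n) * φ
    -π<nφ = <-respˡ (trans (solve 2 (λ m θ → m :* :- θ := :- (m :* θ)) refl (fromNat (suc n)) θ) (-‿cong nθ≈π))
      (*-monoˡ-< (fromNat-pos n) (proj₁ φ-bounds))

theorem2p12 : (ℝ : CompleteOrderedField) →
    let open Real ℝ
        open Complex ℝ
        open Polynomial ℝ
    in
    (n : ℕ) → n ≥ 1 →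
    (a : Vector Carrier (suc n)) → 0# < a (fromℕ n) →
    signChanges a ≥ 1 →
    (v : Carrier) → IsBound a v →
    (π : Carrier) → IsPi π →
    (z : ℂ) → Sector v (π / fromNat n) z →
    ¬ (eval a z ≈ℂ 0ℂ)
theorem2p12 ℝ n n≥1 a 0<aₙ _ = Sectors.sector-free ℝ n n≥1 a 0<aₙ
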